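{- Let $N$ be a finite set and let $f: 2^{N} \to \mathbb{R} \cup \{ -\infty\}$ be an M$^\natural$-concave function. Then $f$ has the multiple exchange property: for any $X, Y \subseteq N$ and any $I \subseteq X \setminus Y$, there exists $J \subseteq Y \setminus X$ such that $$f(X) + f(Y) \leq f((X \setminus I) \cup J) + f((Y \setminus J) \cup I).$$
   Context: For $f: 2^N \to \mathbb{R}\cup\{ -\infty\}$, $\mathrm{dom}\, f = \{X \subseteq N : f(X) > -\infty\}$. Notation: $X - i = X \setminus \{i\}$, $Y + i = Y \cup \{i\}$, $X - i + j = (X\setminus\{i\})\cup\{j\}$, $Y + i - j = (Y \cup\{i\})\setminus\{j\}$. Conventions: $(-\infty)+a = a+(-\infty) = (-\infty)+(-\infty) = -\infty$ for $a \in \mathbb{R}$, $-\infty \le -\infty$, and a maximum over an empty set is $-\infty$. A function $f: 2^N \to \mathbb{R}\cup\{ -\infty\}$ with $\mathrm{dom}\, f \neq \emptyset$ is M$^\natural$-concave if for all $X, Y \subseteq N$ and $i \in X \setminus Y$: $$f(X)+f(Y) \le \max\Big[ f(X-i)+f(Y+i),\ \max_{j \in Y\setminus X}\{ f(X-i+j)+f(Y+i-j)\}\Big].$$ -}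

module Defs where

import Algebra.Properties.CommutativeSemigroup
import Algebra.Properties.Group
open import Algebra.Bundles using (CommutativeMonoid)
open import Data.Fin using (Fin)
open import Data.Fin.Subset using (Subset; ⁅_⁆; _∈_; _∪_; _─_; _-_)
open import Data.Fin.Subset.Properties using (_∈?_)
open import Data.List using (List; foldr; map; filter; allFin)
open import Data.Nat as ℕ using (ℕ)
import Data.Nat.Properties as ℕ
open import Data.Product using (∃-syntax; _×_; _,_)
open import Data.Rational as ℚ using (ℚ; 0ℚ; ½; ∣_∣)
import Data.Rational.Properties as ℚ
open import Data.Sum using (inj₁; inj₂)
open import Relation.Binary.PropositionalEquality
open import Relation.Nullary.Construct.Add.Infimum using (_₋; ⊥₋; [_])

open Algebra.Properties.Group ℚ.+-0-group using (⁻¹-anti-homo-//)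
open Algebra.Properties.CommutativeSemigroup
  (CommutativeMonoid.commutativeSemigroup ℚ.+-0-commutativeMonoid)
  using (interchange)

-- Real numbers are Cauchy sequences of rationals.  No quotient is formed:
-- two sequences represent the same real when each is ≤ℝ the other.

Cauchy : (ℕ → ℚ) → Set
Cauchy s = ∀ ε → 0ℚ ℚ.< ε →
  ∃[ K ] (∀ m n → K ℕ.≤ m → K ℕ.≤ n → ∣ s m ℚ.- s n ∣ ℚ.< ε)

record ℝ : Set where
  constructor mkℝ
  field
    seq    : ℕ → ℚ
    cauchy : Cauchy seq

open ℝ public

infix 4 _≤ℝ_ _<ℝ_

_≤ℝ_ : ℝ → ℝ → Set
x ≤ℝ y = ∀ ε → 0ℚ ℚ.< ε →
  ∃[ K ] (∀ n → K ℕ.≤ n → seq x n ℚ.≤ seq y n ℚ.+ ε)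

_<ℝ_ : ℝ → ℝ → Set
x <ℝ y = ∃[ ε ] (0ℚ ℚ.< ε ×
  ∃[ K ] (∀ n → K ℕ.≤ n → seq x n ℚ.+ ε ℚ.≤ seq y n))

0<½*ε : ∀ {ε} → 0ℚ ℚ.< ε → 0ℚ ℚ.< ½ ℚ.* ε
0<½*ε {ε} 0<ε = subst (ℚ._< ½ ℚ.* ε) (ℚ.*-zeroʳ ½) (ℚ.*-monoʳ-<-pos ½ 0<ε)

½*ε+½*ε≡ε : ∀ ε → ½ ℚ.* ε ℚ.+ ½ ℚ.* ε ≡ ε
½*ε+½*ε≡ε ε = trans (sym (ℚ.*-distribʳ-+ ε ½ ½)) (ℚ.*-identityˡ ε)

p≤∣p∣ : ∀ p → p ℚ.≤ ∣ p ∣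
p≤∣p∣ p with ℚ.≤-total 0ℚ p
... | inj₁ 0≤p = ℚ.≤-reflexive (sym (ℚ.0≤p⇒∣p∣≡p 0≤p))
... | inj₂ p≤0 = ℚ.≤-trans p≤0 (ℚ.0≤∣p∣ p)

-[p-q]≡q-p : ∀ p q → ℚ.- (p ℚ.- q) ≡ q ℚ.- p
-[p-q]≡q-p = ⁻¹-anti-homo-//

∣p-q∣<ε : ∀ {p q ε} → p ℚ.- q ℚ.< ε → q ℚ.- p ℚ.< ε → ∣ p ℚ.- q ∣ ℚ.< ε
∣p-q∣<ε {p} {q} {ε} p-q<ε q-p<ε with ℚ.∣p∣≡p∨∣p∣≡-p (p ℚ.- q)
... | inj₁ eq = subst (ℚ._< ε) (sym eq) p-q<ε
... | inj₂ eq = subst (ℚ._< ε) (sym (trans eq (-[p-q]≡q-p p q))) q-p<ε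

[a+b]-[c+d]≡[a-c]+[b-d] : ∀ a b c d →
  (a ℚ.+ b) ℚ.- (c ℚ.+ d) ≡ (a ℚ.- c) ℚ.+ (b ℚ.- d)
[a+b]-[c+d]≡[a-c]+[b-d] a b c d = trans
  (cong (a ℚ.+ b ℚ.+_) (ℚ.neg-distrib-+ c d))
  (interchange a b (ℚ.- c) (ℚ.- d))

⊔-diff< : ∀ {a b c d ε} → ∣ a ℚ.- c ∣ ℚ.< ε → ∣ b ℚ.- d ∣ ℚ.< ε →
  (a ℚ.⊔ b) ℚ.- (c ℚ.⊔ d) ℚ.< ε
⊔-diff< {a} {b} {c} {d} ac bd with ℚ.⊔-sel a b
... | inj₁ eq = ℚ.≤-<-trans
  (ℚ.≤-trans (subst (λ t → t ℚ.- (c ℚ.⊔ d) ℚ.≤ a ℚ.- c) (sym eq)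
                (ℚ.+-monoʳ-≤ a (ℚ.neg-antimono-≤ (ℚ.p≤p⊔q c d))))
             (p≤∣p∣ (a ℚ.- c))) ac
... | inj₂ eq = ℚ.≤-<-trans
  (ℚ.≤-trans (subst (λ t → t ℚ.- (c ℚ.⊔ d) ℚ.≤ b ℚ.- d) (sym eq)
                (ℚ.+-monoʳ-≤ b (ℚ.neg-antimono-≤ (ℚ.p≤q⊔p c d))))
             (p≤∣p∣ (b ℚ.- d))) bd

infixl 6 _+ℝ_ _⊔ℝ_

_+ℝ_ : ℝ → ℝ → ℝ
seq    (x +ℝ y) n = seq x n ℚ.+ seq y n
cauchy (x +ℝ y) ε 0<ε
  with cauchy x (½ ℚ.* ε) (0<½*ε 0<ε) | cauchy y (½ ℚ.* ε) (0<½*ε 0<ε)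
... | K , hx | L , hy = K ℕ.⊔ L , λ m n Km Kn →
  subst₂ (λ s t → ∣ s ∣ ℚ.< t)
    (sym ([a+b]-[c+d]≡[a-c]+[b-d] (seq x m) (seq y m) (seq x n) (seq y n)))
    (½*ε+½*ε≡ε ε)
    (ℚ.≤-<-trans
      (ℚ.∣p+q∣≤∣p∣+∣q∣ (seq x m ℚ.- seq x n) (seq y m ℚ.- seq y n))
      (ℚ.+-mono-<
        (hx m n (ℕ.m⊔n≤o⇒m≤o K L Km) (ℕ.m⊔n≤o⇒m≤o K L Kn))
        (hy m n (ℕ.m⊔n≤o⇒n≤o K L Km) (ℕ.m⊔n≤o⇒n≤o K L Kn))))

_⊔ℝ_ : ℝ → ℝ → ℝ
seq    (x ⊔ℝ y) n = seq x n ℚ.⊔ seq y n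
cauchy (x ⊔ℝ y) ε 0<ε with cauchy x ε 0<ε | cauchy y ε 0<ε
... | K , hx | L , hy = K ℕ.⊔ L , λ m n Km Kn →
  let Km₁ = ℕ.m⊔n≤o⇒m≤o K L Km
      Kn₁ = ℕ.m⊔n≤o⇒m≤o K L Kn
      Km₂ = ℕ.m⊔n≤o⇒n≤o K L Km
      Kn₂ = ℕ.m⊔n≤o⇒n≤o K L Kn
  in ∣p-q∣<ε {seq x m ℚ.⊔ seq y m} {seq x n ℚ.⊔ seq y n}
       (⊔-diff< {seq x m} {seq y m} {seq x n} {seq y n}
         (hx m n Km₁ Kn₁) (hy m n Km₂ Kn₂))
       (⊔-diff< {seq x n} {seq y n} {seq x m} {seq y m}
         (hx n m Kn₁ Km₁) (hy n m Kn₂ Km₂))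

-- ℝ ₋ is ℝ ∪ {-∞}, with -∞ written ⊥₋.

open import Relation.Binary.Construct.Add.Infimum.NonStrict _≤ℝ_ public
  using (_≤₋_; ⊥₋≤_; [_])
open import Relation.Binary.Construct.Add.Infimum.Strict _<ℝ_ public
  using (_<₋_; ⊥₋<[_]; [_])

infixl 6 _+₋_ _⊔₋_

_+₋_ : ℝ ₋ → ℝ ₋ → ℝ ₋
[ x ] +₋ [ y ] = [ x +ℝ y ]
[ x ] +₋ ⊥₋    = ⊥₋
⊥₋    +₋ b     = ⊥₋

_⊔₋_ : ℝ ₋ → ℝ ₋ → ℝ ₋
[ x ] ⊔₋ [ y ] = [ x ⊔ℝ y ]
[ x ] ⊔₋ ⊥₋    = [ x ]
⊥₋    ⊔₋ b     = b

max : List (ℝ ₋) → ℝ ₋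
max = foldr _⊔₋_ ⊥₋

module _ {n : ℕ} where

  infixl 5 _⊕_

  _⊕_ : Subset n → Fin n → Subset n
  X ⊕ i = X ∪ ⁅ i ⁆

  elements : Subset n → List (Fin n)
  elements X = filter (_∈? X) (allFin n)

  maxOver : Subset n → (Fin n → ℝ ₋) → ℝ ₋
  maxOver X g = max (map g (elements X))

  _∈dom_ : Subset n → (Subset n → ℝ ₋) → Set
  X ∈dom f = ⊥₋ <₋ f X

  record M♮-Concave (f : Subset n → ℝ ₋) : Set where
    field
      dom-nonempty : ∃[ X ] X ∈dom f
      exchange     : ∀ X Y i → i ∈ X ─ Y →
        f X +₋ f Y ≤₋
          (f (X - i) +₋ f (Y ⊕ i)) ⊔₋
          maxOver (Y ─ X) (λ j → f (X - i ⊕ j) +₋ f (Y ⊕ i - j))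

{-# OPTIONS --safe #-}
module Submission where

-- Put B = Y \ X.  For J ⊆ B both J ↦ f((X \ I) ∪ J) and, up to complementing
-- J, J ↦ f((Y \ J) ∪ I) are M♮-concave, and the claim is that their sum has
-- maximum at least c = f(X) + f(Y).  By a strong duality (weight splitting) it
-- suffices that for every q on B the maxima of the first function + q and of
-- the second − q add up to at least c; here the two sets may be chosen
-- independently, and the inequality is the submodularity of
-- K ↦ max { f(K ∪ J) + q(J) : J ⊆ B }, which follows from single exchanges.
--
-- The duality is proved by induction on the set of coordinates on which the
-- two sets must agree.  For a new coordinate e, a gap would come from optimal
-- pairs disagreeing at e in the two possible ways; after a shift both have the
-- same level m.  Lowering both weights at e by 1, respectively raising them by
-- 1, the induction hypothesis yields dual solutions q below m and r below
-- m + 2.  The conjugate g(q) = max { f(Z) + q(Z) } is submodular, so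
-- exchanging joins and meets of q and r gives two dual solutions of total
-- value below 2m + 2, whereas each has value at least m + 1.

open import Defs
open import Algebra.Bundles using (CommutativeMonoid)
import Algebra.Properties.CommutativeSemigroup
import Algebra.Solver.CommutativeMonoid
open import Axiom.ExcludedMiddle using (ExcludedMiddle)
open import Data.Bool using (Bool; true; false; if_then_else_; not; _∧_; _∨_)
open import Data.Bool.Properties
  using (not-involutive; ∧-zeroʳ; ∧-identityʳ; ∨-zeroʳ; ∨-identityʳ)
open import Data.Empty using (⊥; ⊥-elim)
open import Data.Fin using (Fin; zero; suc; _≟_)
open import Data.Fin.Subset
  using (Subset; _⊆_; _∪_; _─_; _-_; _∩_; _∈_; ∁; ⁅_⁆) renaming (⊥ to ∅)
open import Data.Fin.Subset.Properties
  using (_∈?_; ∉⊥; x∈⁅x⁆; x≢y⇒x∉⁅y⁆; p∩q⊆q)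
open import Data.List using (List; []; _∷_; map; _++_; cartesianProduct; allFin; filter)
open import Data.List.Membership.Propositional
  using () renaming (_∈_ to _∈ₗ_; _∉_ to _∉ₗ_)
open import Data.List.Membership.Propositional.Properties
  using (∈-++⁺ˡ; ∈-++⁺ʳ; ∈-map⁺; ∈-allFin; ∈-filter⁺; ∈-filter⁻; ∈-cartesianProduct⁺)
open import Data.List.Relation.Unary.Any using (here; there)
open import Data.Nat as ℕ using (ℕ; zero; suc)
import Data.Nat.Properties as ℕ
open import Data.Product using (∃; ∃-syntax; _×_; _,_; proj₁; proj₂; swap)
open import Data.Rational as ℚ using (ℚ; 0ℚ; 1ℚ; ½; ∣_∣)
import Data.Rational.Properties as ℚ
open import Data.Sum as Sum using (_⊎_; inj₁; inj₂; [_,_]′)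
open import Data.Vec using ([]; _∷_; lookup)
open import Data.Vec.Functional using (Vector; updateAt)
open import Data.Vec.Functional.Properties using (updateAt-updates; updateAt-minimal)
open import Data.Vec.Properties using
  (lookup-map; lookup-zipWith; map-∘; map-cong; map-id; []=⇒lookup; lookup⇒[]=;
   tabulate∘lookup; tabulate-cong)
open import Function using (_∘_)
open import Level using (0ℓ)
open import Relation.Binary.Bundles using (Poset)
open import Relation.Binary.PropositionalEquality
  using (_≡_; _≢_; refl; sym; trans; cong; cong₂; subst; subst₂)
import Relation.Binary.Reasoning.PartialOrder
open import Relation.Binary.Structures using (IsTotalOrder)
open import Relation.Nullary using (¬_; yes; no; contradiction)
open import Relation.Nullary.Construct.Add.Infimum using (_₋; ⊥₋; [_])
open import Relation.Nullary.Decidable using (from-no)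

open Algebra.Properties.CommutativeSemigroup
  (CommutativeMonoid.commutativeSemigroup ℚ.+-0-commutativeMonoid)
  using (interchange)

-- Cauchy reals as an ordered abelian group

const : ℚ → ℝ
const p = mkℝ (λ _ → p) λ ε 0<ε → 0 , λ _ _ _ _ →
  subst (λ t → ∣ t ∣ ℚ.< ε) (sym (ℚ.+-inverseʳ p)) 0<ε

0ℝ 1ℝ : ℝ
0ℝ = const 0ℚ
1ℝ = const 1ℚ

-ℝ_ : ℝ → ℝ
seq    (-ℝ x) n = ℚ.- seq x n
cauchy (-ℝ x) ε 0<ε with cauchy x ε 0<ε
... | K , h = K , λ m n Km Kn →
  subst (ℚ._< ε)
    (trans (sym (ℚ.∣-p∣≡∣p∣ (seq x m ℚ.- seq x n)))
           (cong ∣_∣ (ℚ.neg-distrib-+ (seq x m) (ℚ.- seq x n))))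
    (h m n Km Kn)

½ℝ_ : ℝ → ℝ
seq    (½ℝ x) n = ½ ℚ.* seq x n
cauchy (½ℝ x) ε 0<ε with cauchy x (ε ℚ.+ ε) (ℚ.+-mono-< 0<ε 0<ε)
... | K , h = K , λ m n Km Kn → subst₂ ℚ._<_
  (trans (sym (ℚ.∣p*q∣≡∣p∣*∣q∣ ½ (seq x m ℚ.- seq x n))) (cong ∣_∣
    (trans (ℚ.*-distribˡ-+ ½ (seq x m) (ℚ.- seq x n))
           (cong (½ ℚ.* seq x m ℚ.+_) (sym (ℚ.neg-distribʳ-* ½ (seq x n)))))))
  (trans (ℚ.*-distribˡ-+ ½ ε ε) (½*ε+½*ε≡ε ε))
  (ℚ.*-monoʳ-<-pos ½ (h m n Km Kn))

≤-+ε : ∀ {p q ε} → 0ℚ ℚ.< ε → p ℚ.≤ q → p ℚ.≤ q ℚ.+ ε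
≤-+ε {p} {q} 0<ε p≤q = ℚ.≤-trans p≤q
  (subst (ℚ._≤ q ℚ.+ _) (ℚ.+-identityʳ q) (ℚ.+-monoʳ-≤ q (ℚ.<⇒≤ 0<ε)))

pointwise⇒≤ℝ : ∀ {x y} → (∀ n → seq x n ≡ seq y n) → x ≤ℝ y
pointwise⇒≤ℝ x≗y ε 0<ε = 0 , λ n _ → ≤-+ε 0<ε (ℚ.≤-reflexive (x≗y n))

≤ℝ-refl : ∀ {x} → x ≤ℝ x
≤ℝ-refl {x} = pointwise⇒≤ℝ {x} {x} λ _ → refl

≤ℝ-trans : ∀ {x y z} → x ≤ℝ y → y ≤ℝ z → x ≤ℝ z
≤ℝ-trans {z = z} x≤y y≤z ε 0<ε
  with x≤y (½ ℚ.* ε) (0<½*ε 0<ε) | y≤z (½ ℚ.* ε) (0<½*ε 0<ε)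
... | K , h | L , k = K ℕ.⊔ L , λ n Kn → ℚ.≤-trans
  (ℚ.≤-trans (h n (ℕ.m⊔n≤o⇒m≤o K L Kn))
             (ℚ.+-monoˡ-≤ (½ ℚ.* ε) (k n (ℕ.m⊔n≤o⇒n≤o K L Kn))))
  (ℚ.≤-reflexive (trans (ℚ.+-assoc (seq z n) _ _)
                        (cong (seq z n ℚ.+_) (½*ε+½*ε≡ε ε))))

+ℝ-mono-≤ : ∀ {x y u v} → x ≤ℝ y → u ≤ℝ v → x +ℝ u ≤ℝ y +ℝ v
+ℝ-mono-≤ {y = y} {v = v} x≤y u≤v ε 0<ε
  with x≤y (½ ℚ.* ε) (0<½*ε 0<ε) | u≤v (½ ℚ.* ε) (0<½*ε 0<ε)
... | K , h | L , k = K ℕ.⊔ L , λ n Kn → ℚ.≤-trans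
  (ℚ.+-mono-≤ (h n (ℕ.m⊔n≤o⇒m≤o K L Kn)) (k n (ℕ.m⊔n≤o⇒n≤o K L Kn)))
  (ℚ.≤-reflexive (trans (interchange (seq y n) _ (seq v n) _)
                        (cong (seq y n ℚ.+ seq v n ℚ.+_) (½*ε+½*ε≡ε ε))))

infix 4 _≈ℝ_
_≈ℝ_ : ℝ → ℝ → Set
x ≈ℝ y = x ≤ℝ y × y ≤ℝ x

pointwise⇒≈ℝ : ∀ {x y} → (∀ n → seq x n ≡ seq y n) → x ≈ℝ y
pointwise⇒≈ℝ {x} {y} x≗y =
  pointwise⇒≤ℝ {x} {y} x≗y , pointwise⇒≤ℝ {y} {x} (λ n → sym (x≗y n))

≤ℝ-poset : Poset 0ℓ 0ℓ 0ℓ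
≤ℝ-poset = record
  { Carrier = ℝ ; _≈_ = _≈ℝ_ ; _≤_ = _≤ℝ_
  ; isPartialOrder = record
    { isPreorder = record
      { isEquivalence = record
        { refl  = λ {x} → ≤ℝ-refl {x} , ≤ℝ-refl {x}
        ; sym   = swap
        ; trans = λ {x} {y} {z} (p , p′) (q , q′) →
            ≤ℝ-trans {x} {y} {z} p q , ≤ℝ-trans {z} {y} {x} q′ p′ }
      ; reflexive = proj₁
      ; trans     = λ {x} {y} {z} → ≤ℝ-trans {x} {y} {z} }
    ; antisym = _,_ } }

+ℝ-commutativeMonoid : CommutativeMonoid 0ℓ 0ℓ
+ℝ-commutativeMonoid = record
  { Carrier = ℝ ; _≈_ = _≈ℝ_ ; _∙_ = _+ℝ_ ; ε = 0ℝ
  ; isCommutativeMonoid = record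
    { isMonoid = record
      { isSemigroup = record
        { isMagma = record
          { isEquivalence = Poset.isEquivalence ≤ℝ-poset
          ; ∙-cong = λ {x} {y} {u} {v} (p , p′) (q , q′) →
              +ℝ-mono-≤ {x} {y} {u} {v} p q , +ℝ-mono-≤ {y} {x} {v} {u} p′ q′ }
        ; assoc = λ x y z → pointwise⇒≈ℝ {(x +ℝ y) +ℝ z} {x +ℝ (y +ℝ z)}
            λ n → ℚ.+-assoc (seq x n) (seq y n) (seq z n) }
      ; identity = (λ x → pointwise⇒≈ℝ {0ℝ +ℝ x} {x} λ n → ℚ.+-identityˡ (seq x n))
                 , (λ x → pointwise⇒≈ℝ {x +ℝ 0ℝ} {x} λ n → ℚ.+-identityʳ (seq x n)) }
    ; comm = λ x y → pointwise⇒≈ℝ {x +ℝ y} {y +ℝ x} λ n → ℚ.+-comm (seq x n) (seq y n) } }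

+ℝ-inverseʳ : ∀ x → x +ℝ (-ℝ x) ≈ℝ 0ℝ
+ℝ-inverseʳ x = pointwise⇒≈ℝ {x +ℝ (-ℝ x)} {0ℝ} λ n → ℚ.+-inverseʳ (seq x n)

½ℝ+½ℝ : ∀ x → (½ℝ x) +ℝ (½ℝ x) ≈ℝ x
½ℝ+½ℝ x = pointwise⇒≈ℝ {(½ℝ x) +ℝ (½ℝ x)} {x} λ n → ½*ε+½*ε≡ε (seq x n)

1ℝ≰0ℝ : ¬ 1ℝ ≤ℝ 0ℝ
1ℝ≰0ℝ 1≤0 with 1≤0 ½ (ℚ.positive⁻¹ ½)
... | K , h = from-no (1ℚ ℚ.≤? 0ℚ ℚ.+ ½) (h K ℕ.≤-refl)

∣p-q∣<ε⇒p≤q+ε : ∀ p q {ε} → ∣ p ℚ.- q ∣ ℚ.< ε → p ℚ.≤ q ℚ.+ ε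
∣p-q∣<ε⇒p≤q+ε p q {ε} h = subst₂ ℚ._≤_
  (trans (ℚ.+-assoc p (ℚ.- q) q)
    (trans (cong (p ℚ.+_) (ℚ.+-inverseˡ q)) (ℚ.+-identityʳ p)))
  (ℚ.+-comm ε q)
  (ℚ.+-monoˡ-≤ q (ℚ.≤-trans (p≤∣p∣ (p ℚ.- q)) (ℚ.<⇒≤ h)))

module _ (em : ExcludedMiddle 0ℓ) where

  -- Suppose `y ≤ℝ x` fails at tolerance δ. Past the Cauchy moduli of both sequences for δ/2, no
  -- index `n` can have `seq y n ≤ seq x n`: that one inequality would persist, with tolerance δ, at
  -- all later indices. So `seq x n ≤ seq y n` holds eventually, which gives `x ≤ℝ y`.
  ≤ℝ-total : ∀ x y → x ≤ℝ y ⊎ y ≤ℝ x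
  ≤ℝ-total x y with em {x ≤ℝ y}
  ... | yes x≤y = inj₁ x≤y
  ... | no  x≰y = inj₂ y≤x
    where
    y≤x : y ≤ℝ x
    y≤x δ 0<δ with em {∃[ n ] (∀ m → n ℕ.≤ m → seq y m ℚ.≤ seq x m ℚ.+ δ)}
    ... | yes h = h
    ... | no  ¬h = contradiction x≤y x≰y
      where
      x≤y : x ≤ℝ y
      x≤y ε 0<ε
        with cauchy x (½ ℚ.* δ) (0<½*ε 0<δ) | cauchy y (½ ℚ.* δ) (0<½*ε 0<δ)
      ... | K , hx | L , hy = K ℕ.⊔ L , below
        where
        below : ∀ n → K ℕ.⊔ L ℕ.≤ n → seq x n ℚ.≤ seq y n ℚ.+ ε
        below n Kn with ℚ.≤-total (seq x n) (seq y n)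
        ... | inj₁ xn≤yn = ≤-+ε 0<ε xn≤yn
        ... | inj₂ yn≤xn = contradiction (n , λ m n≤m → ℚ.≤-trans
          (∣p-q∣<ε⇒p≤q+ε (seq y m) (seq y n) (hy m n (ℕ.≤-trans (ℕ.m⊔n≤o⇒n≤o K L Kn) n≤m) (ℕ.m⊔n≤o⇒n≤o K L Kn)))
          (ℚ.≤-trans (ℚ.+-monoˡ-≤ (½ ℚ.* δ) yn≤xn)
          (ℚ.≤-trans (ℚ.+-monoˡ-≤ (½ ℚ.* δ) (∣p-q∣<ε⇒p≤q+ε
            (seq x n) (seq x m) (hx n m (ℕ.m⊔n≤o⇒m≤o K L Kn) (ℕ.≤-trans (ℕ.m⊔n≤o⇒m≤o K L Kn) n≤m))))
          (ℚ.≤-reflexive (trans (ℚ.+-assoc (seq x m) (½ ℚ.* δ) (½ ℚ.* δ))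
            (cong (seq x m ℚ.+_) (½*ε+½*ε≡ε δ))))))) ¬h

-- Collects what the combinatorial argument uses of the reals. `1#` provides a strictly positive
-- amount, of no particular size, and `half` serves to move two values to their midpoint.
record DivisibleOrderedGroup : Set₁ where
  field
    +-commutativeMonoid : CommutativeMonoid 0ℓ 0ℓ
  open CommutativeMonoid +-commutativeMonoid public
    using (_≈_)
    renaming (Carrier to R; _∙_ to _+_; ε to 0#)
  infix 4 _≤_
  field
    _≤_          : R → R → Set
    isTotalOrder : IsTotalOrder _≈_ _≤_
    +-mono-≤     : ∀ {x y u v} → x ≤ y → u ≤ v → x + u ≤ y + v
    negative     : ∀ x → ∃[ y ] x + y ≈ 0#
    half         : ∀ x → ∃[ y ] y + y ≈ x
    1#           : R
    1≰0          : ¬ 1# ≤ 0#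

subsets : ∀ n → List (Subset n)
subsets zero    = [] ∷ []
subsets (suc n) = map (true ∷_) (subsets n) ++ map (false ∷_) (subsets n)

∈-subsets : ∀ {n} (Z : Subset n) → Z ∈ₗ subsets n
∈-subsets []          = here refl
∈-subsets (true  ∷ Z) = ∈-++⁺ˡ (∈-map⁺ (true ∷_) (∈-subsets Z))
∈-subsets (false ∷ Z) =
  ∈-++⁺ʳ (map (true ∷_) (subsets _)) (∈-map⁺ (false ∷_) (∈-subsets Z))

-- Order arithmetic and finite maxima

module ValuatedExchange (em : ExcludedMiddle 0ℓ) (G : DivisibleOrderedGroup) where

  open DivisibleOrderedGroup G
  open IsTotalOrder isTotalOrder using (total; isPartialOrder)
    renaming (refl to ≤-refl; trans to ≤-trans; reflexive to ≤-reflexive; module Eq to ≈)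
  open CommutativeMonoid +-commutativeMonoid
    using () renaming (∙-cong to +-cong; identityʳ to +-identityʳ; comm to +-comm)
  open Algebra.Solver.CommutativeMonoid +-commutativeMonoid
    using (solve; _⊜_; id) renaming (_⊕_ to _:+_)

  poset : Poset 0ℓ 0ℓ 0ℓ
  poset = record { isPartialOrder = isPartialOrder }

  open Relation.Binary.Reasoning.PartialOrder poset

  +-monoˡ-≤ : ∀ z {x y} → x ≤ y → x + z ≤ y + z
  +-monoˡ-≤ z x≤y = +-mono-≤ x≤y ≤-refl

  +-monoʳ-≤ : ∀ z {x y} → x ≤ y → z + x ≤ z + y
  +-monoʳ-≤ z x≤y = +-mono-≤ ≤-refl x≤y

  +-cancelʳ-≤ : ∀ z {x y} → x + z ≤ y + z → x ≤ y
  +-cancelʳ-≤ z {x} {y} x+z≤y+z with negative z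
  ... | z⁻ , z+z⁻≈0 = begin
    x              ≈⟨ undo x ⟨
    (x + z) + z⁻   ≤⟨ +-monoˡ-≤ z⁻ x+z≤y+z ⟩
    (y + z) + z⁻   ≈⟨ undo y ⟩
    y              ∎
    where
    undo : ∀ x → (x + z) + z⁻ ≈ x
    undo x = ≈.trans (solve 3 (λ x z z⁻ → (x :+ z) :+ z⁻ ⊜ x :+ (z :+ z⁻)) ≈.refl x z z⁻)
      (≈.trans (+-cong ≈.refl z+z⁻≈0) (+-identityʳ x))

  -- Chains two exchange inequalities through the intermediate set scoring `u`. In the applications
  -- `m` belongs to a maximiser and `m′` to a competitor, so the auxiliary maximiser drops out of
  -- the result.
  +-splice : ∀ {a m u v z w m′} → a + m ≤ u + v → u + z ≤ w + m′ → m′ ≤ m → a + z ≤ w + v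
  +-splice {a} {m} {u} {v} {z} {w} {m′} p q r = +-cancelʳ-≤ (u + m) (begin
    (a + z) + (u + m)    ≈⟨ solve 4 (λ a z u m → (a :+ z) :+ (u :+ m) ⊜ (a :+ m) :+ (u :+ z)) ≈.refl a z u m ⟩
    (a + m) + (u + z)    ≤⟨ +-mono-≤ p (≤-trans q (+-monoʳ-≤ w r)) ⟩
    (u + v) + (w + m)    ≈⟨ solve 4 (λ u v w m → (u :+ v) :+ (w :+ m) ⊜ (w :+ v) :+ (u :+ m)) ≈.refl u v w m ⟩
    (w + v) + (u + m)    ∎)

  +-interchange : ∀ a b c d → (a + b) + (c + d) ≈ (a + c) + (b + d)
  +-interchange = solve 4 (λ a b c d → (a :+ b) :+ (c :+ d) ⊜ (a :+ c) :+ (b :+ d)) ≈.refl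

  escape : ∀ c x → ∃[ d ] ¬ c ≤ x + d
  escape c x with negative x | negative 1#
  ... | x⁻ , x+x⁻≈0 | ν , 1+ν≈0 = x⁻ + (c + ν) , λ c≤ → 1≰0 (+-cancelʳ-≤ c (begin
    1# + c                          ≤⟨ +-monoʳ-≤ 1# c≤ ⟩
    1# + (x + (x⁻ + (c + ν)))       ≈⟨ solve 5 (λ i x x⁻ c ν → i :+ (x :+ (x⁻ :+ (c :+ ν))) ⊜ ((x :+ x⁻) :+ (i :+ ν)) :+ c) ≈.refl 1# x x⁻ c ν ⟩
    ((x + x⁻) + (1# + ν)) + c       ≈⟨ +-cong (+-cong x+x⁻≈0 1+ν≈0) ≈.refl ⟩
    (0# + 0#) + c                   ≈⟨ +-cong (+-identityʳ 0#) ≈.refl ⟩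
    0# + c                          ∎))

  -- With h half of y - x, the witnesses are -h and h: both values move to their midpoint while the
  -- total shift stays zero.
  equalise : ∀ x y → ∃[ a ] ∃[ b ] a + b ≈ 0# × x + b ≈ y + a
  equalise x y with negative x
  ... | x⁻ , x+x⁻≈0 with half (y + x⁻)
  ...   | h , h+h≈ with negative h
  ...     | h⁻ , h+h⁻≈0 = h⁻ , h , ≈.trans (+-comm h⁻ h) h+h⁻≈0 , (begin-equality
    x + h                     ≈⟨ +-identityʳ (x + h) ⟨
    (x + h) + 0#              ≈⟨ +-cong ≈.refl h+h⁻≈0 ⟨
    (x + h) + (h + h⁻)        ≈⟨ solve 3 (λ x h h⁻ → (x :+ h) :+ (h :+ h⁻) ⊜ x :+ ((h :+ h) :+ h⁻)) ≈.refl x h h⁻ ⟩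
    x + ((h + h) + h⁻)        ≈⟨ +-cong ≈.refl (+-cong h+h≈ ≈.refl) ⟩
    x + ((y + x⁻) + h⁻)       ≈⟨ solve 4 (λ x y x⁻ h⁻ → x :+ ((y :+ x⁻) :+ h⁻) ⊜ (y :+ h⁻) :+ (x :+ x⁻)) ≈.refl x y x⁻ h⁻ ⟩
    (y + h⁻) + (x + x⁻)       ≈⟨ +-cong ≈.refl x+x⁻≈0 ⟩
    (y + h⁻) + 0#             ≈⟨ +-identityʳ (y + h⁻) ⟩
    y + h⁻                    ∎)

  -- The given element `a` is the initial best candidate, so the list itself need not contain an
  -- element satisfying `P`.
  argmax : ∀ {A : Set} (P : A → Set) (φ : A → R) (xs : List A) {a} → P a →
    ∃[ m ] P m × φ a ≤ φ m × (∀ {b} → b ∈ₗ xs → P b → φ b ≤ φ m)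
  argmax P φ []       {a} Pa = a , Pa , ≤-refl , λ ()
  argmax P φ (x ∷ xs) {a} Pa with em {P x}
  ... | no ¬Px with argmax P φ xs Pa
  ...   | m , Pm , a≤m , bound = m , Pm , a≤m , λ where
            (here refl) Pb → contradiction Pb ¬Px
            (there b∈)  Pb → bound b∈ Pb
  argmax P φ (x ∷ xs) {a} Pa | yes Px with total (φ a) (φ x)
  ... | inj₁ a≤x with argmax P φ xs Px
  ...   | m , Pm , x≤m , bound = m , Pm , ≤-trans a≤x x≤m , λ where
            (here refl) _  → x≤m
            (there b∈)  Pb → bound b∈ Pb
  argmax P φ (x ∷ xs) {a} Pa | yes Px | inj₂ x≤a with argmax P φ xs Pa
  ...   | m , Pm , a≤m , bound = m , Pm , a≤m , λ where
            (here refl) _  → ≤-trans x≤a a≤m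
            (there b∈)  Pb → bound b∈ Pb

  module _ {n : ℕ} where

    maximum : (P : Subset n → Set) (φ : Subset n → R) → ∃ P →
      ∃[ M ] P M × (∀ {Z} → P Z → φ Z ≤ φ M)
    maximum P φ (_ , PZ) with argmax P φ (subsets n) PZ
    ... | M , PM , _ , bound = M , PM , bound (∈-subsets _)

    maximum₂ : (P : Subset n × Subset n → Set) (φ : Subset n × Subset n → R) → ∃ P →
      ∃[ M ] P M × (∀ {Z} → P Z → φ Z ≤ φ M)
    maximum₂ P φ (_ , PZ) with argmax P φ (cartesianProduct (subsets n) (subsets n)) PZ
    ... | M , PM , _ , bound =
      M , PM , λ {Z} → bound (∈-cartesianProduct⁺ (∈-subsets (proj₁ Z)) (∈-subsets (proj₂ Z)))

  -- Linear weights on subsets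

  when : Bool → R → R
  when b x = if b then x else 0#

  weight : ∀ {n} → Vector R n → Subset n → R
  weight q []      = 0#
  weight q (b ∷ Z) = when b (q zero) + weight (q ∘ suc) Z

  -- An exchange carries elements from one set to the other, so the terms at an element are
  -- comparable only when both sets are taken together.
  weight-mono₂ : ∀ {n} {q r s t : Vector R n} U V W Z →
    (∀ e → when (lookup U e) (q e) + when (lookup V e) (r e) ≤
           when (lookup W e) (s e) + when (lookup Z e) (t e)) →
    weight q U + weight r V ≤ weight s W + weight t Z
  weight-mono₂ [] [] [] [] _ = ≤-refl
  weight-mono₂ (_ ∷ U) (_ ∷ V) (_ ∷ W) (_ ∷ Z) h = begin
    _  ≈⟨ +-interchange _ _ _ _ ⟩
    _  ≤⟨ +-mono-≤ (h zero) (weight-mono₂ U V W Z (h ∘ suc)) ⟩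
    _  ≈⟨ +-interchange _ _ _ _ ⟩
    _  ∎

  shift : ∀ {n} → Vector R n → Fin n → R → Vector R n
  shift p e a = updateAt p e (_+ a)

  weight-shift : ∀ {n} (p : Vector R n) e a Z →
    weight (shift p e a) Z ≈ weight p Z + when (lookup Z e) a
  weight-shift p zero a (true ∷ Z) =
    solve 3 (λ x a y → (x :+ a) :+ y ⊜ (x :+ y) :+ a) ≈.refl (p zero) a _
  weight-shift p zero a (false ∷ Z) = ≈.sym (+-identityʳ _)
  weight-shift p (suc e) a (b ∷ Z) = ≈.trans
    (+-cong (≈.refl {when b (p zero)}) (weight-shift (p ∘ suc) e a Z))
    (solve 3 (λ x y z → x :+ (y :+ z) ⊜ (x :+ y) :+ z) ≈.refl (when b (p zero)) _ _)

  when-zero : ∀ b → when b 0# ≈ 0#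
  when-zero true  = ≈.refl
  when-zero false = ≈.refl

  weight-zero : ∀ {n} (Z : Subset n) → weight (λ _ → 0#) Z ≈ 0#
  weight-zero []      = ≈.refl
  weight-zero (b ∷ Z) = ≈.trans (+-cong (when-zero b) (weight-zero Z)) (+-identityʳ 0#)

  -- Giving the larger weight to the second set can lose only if the element lies in the first set
  -- and not in the second, which is exactly the situation in which the exchange property applies.
  when-swap : ∀ b c {x y} → x ≤ y →
    (b ≡ true × c ≡ false) ⊎ (when b y + when c x ≤ when b x + when c y)
  when-swap true  false _   = inj₁ (refl , refl)
  when-swap true  true  _   = inj₂ (≤-reflexive (solve 2 (λ x y → y :+ x ⊜ x :+ y) ≈.refl _ _))
  when-swap false true  x≤y = inj₂ (+-monoʳ-≤ 0# x≤y)
  when-swap false false _   = inj₂ ≤-refl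

  -- Functions with a relaxed exchange property

  Kept Swapped : (q r hi lo : R) → Set
  Kept    q r hi lo = hi ≡ q × lo ≡ r × r ≤ q
  Swapped q r hi lo = hi ≡ r × lo ≡ q × q ≤ r

  -- In both cases `hi` is the larger and `lo` the smaller of `q` and `r`. Which one is which stays
  -- recorded, because the submodularity proof inducts over the swapped coordinates.
  Mixed : (q r hi lo : R) → Set
  Mixed q r hi lo = Kept q r hi lo ⊎ Swapped q r hi lo

  -- Membership of one element in X, Y, I, (X \ I) ∪ J and (Y \ J) ∪ I; the first
  -- case is the free one, in Y \ X, where z says whether it is in J.
  Cell : (x y i z w : Bool) → Set
  Cell x y i z w =
    (y ≡ true × x ≡ false × w ≡ not z) ⊎
    (¬ (y ≡ true × x ≡ false) × ((i ≡ true × z ≡ false × w ≡ true) ⊎ (i ≡ false × z ≡ x × w ≡ y)))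

  -- A relaxed exchange: any number of elements, not just one, may move from Q
  -- to P in return for i.  This suffices, and it is stable under restriction.
  Moved : ∀ {n} → Fin n → (P Q P′ Q′ : Subset n) → Set
  Moved i P Q P′ Q′ =
    lookup P′ i ≡ false × lookup Q′ i ≡ true × ∀ e → e ≢ i →
      (lookup P′ e ≡ lookup P e × lookup Q′ e ≡ lookup Q e) ⊎
      (lookup P e ≡ false × lookup Q e ≡ true × lookup P′ e ≡ true × lookup Q′ e ≡ false)

  -- A function to R ∪ {-∞}: value is irrelevant outside dom.
  record Valuated (n : ℕ) : Set₁ where
    field
      dom      : Subset n → Set
      value    : Subset n → R
      exchange : ∀ {P Q} i → dom P → dom Q → lookup P i ≡ true → lookup Q i ≡ false →
        ∃[ P′ ] ∃[ Q′ ] dom P′ × dom Q′ × Moved i P Q P′ Q′ ×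
          value P + value Q ≤ value P′ + value Q′

    score : Vector R n → Subset n → R
    score q Z = value Z + weight q Z

  open Valuated

  -- Submodularity of the conjugate

  module _ {n : ℕ} where

    private variable
      q q′ r hi lo lo′ : Vector R n

    score-mono₂ : ∀ (F₁ F₂ : Valuated n) {q r s t : Vector R n} U V W Z →
      value F₁ U + value F₂ V ≤ value F₁ W + value F₂ Z →
      (∀ e → when (lookup U e) (q e) + when (lookup V e) (r e) ≤
             when (lookup W e) (s e) + when (lookup Z e) (t e)) →
      score F₁ q U + score F₂ r V ≤ score F₁ s W + score F₂ t Z
    score-mono₂ F₁ F₂ U V W Z v h = begin
      _  ≈⟨ +-interchange _ _ _ _ ⟩
      _  ≤⟨ +-mono-≤ v (weight-mono₂ U V W Z h) ⟩
      _  ≈⟨ +-interchange _ _ _ _ ⟩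
      _  ∎

    module _ (F : Valuated n) where

      -- Moving `i` from the first set to the second trades the weight `q′ i` for the equal `lo′ i`.
      -- Any other element that moves goes from `Q` to `P′`, trading `lo e` for `q e`, which is at
      -- least as large.
      exchange-score : ∀ i {P Q} → dom F P → dom F Q → lookup P i ≡ true → lookup Q i ≡ false →
        q′ i ≡ lo′ i → (∀ e → e ≢ i → q′ e ≡ q e × lo′ e ≡ lo e × lo e ≤ q e) →
        ∃[ P′ ] ∃[ Q′ ] dom F P′ × dom F Q′ × Moved i P Q P′ Q′ ×
          score F q′ P + score F lo Q ≤ score F q P′ + score F lo′ Q′
      exchange-score {q′ = q′} {lo′ = lo′} {q = q} {lo = lo} i {P} {Q} dP dQ Pi Qi q′i off with exchange F i dP dQ Pi Qi
      ... | P′ , Q′ , dP′ , dQ′ , moved@(P′i , Q′i , rest) , v =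
        P′ , Q′ , dP′ , dQ′ , moved , score-mono₂ F F P Q P′ Q′ v term
        where
        term : ∀ e → when (lookup P e) (q′ e) + when (lookup Q e) (lo e) ≤
                     when (lookup P′ e) (q e) + when (lookup Q′ e) (lo′ e)
        term e with e ≟ i
        ... | yes refl rewrite Pi | Qi | P′i | Q′i | q′i =
          ≤-reflexive (solve 1 (λ x → x :+ id ⊜ id :+ x) ≈.refl (lo′ e))
        ... | no e≢i with off e e≢i | rest e e≢i
        ...   | q′e , lo′e , _ | inj₁ (P′e , Q′e) rewrite P′e | Q′e | q′e | lo′e = ≤-refl
        ...   | _ , _ , loe | inj₂ (Pe , Qe , P′e , Q′e) rewrite Pe | Qe | P′e | Q′e =
          ≤-trans (+-monoʳ-≤ 0# loe)
            (≤-reflexive (solve 1 (λ x → id :+ x ⊜ x :+ id) ≈.refl (q e)))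

      -- The conjugate of F gains at least as much from raising the weight of i on
      -- top of the smaller weights lo as on top of the larger weights q.
      raise : ∀ i {P Q} → dom F P → dom F Q →
        q′ i ≡ lo′ i → q i ≡ lo i → lo i ≤ lo′ i →
        (∀ e → e ≢ i → q′ e ≡ q e × lo′ e ≡ lo e × lo e ≤ q e) →
        ∃[ P′ ] ∃[ Q′ ] dom F P′ × dom F Q′ ×
          score F q′ P + score F lo Q ≤ score F q P′ + score F lo′ Q′
      raise {q′ = q′} {lo′ = lo′} {q = q} {lo = lo} i {P} {Q} dP dQ q′i qi lo≤ off
        with when-swap (lookup P i) (lookup Q i) lo≤
      ... | inj₁ (Pi , Qi) with exchange-score i dP dQ Pi Qi q′i off
      ...   | P′ , Q′ , dP′ , dQ′ , _ , h = P′ , Q′ , dP′ , dQ′ , h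
      raise {q′ = q′} {lo′ = lo′} {q = q} {lo = lo} i {P} {Q} dP dQ q′i qi lo≤ off
          | inj₂ at-i =
        P , Q , dP , dQ , score-mono₂ F F P Q P Q ≤-refl term
        where
        term : ∀ e → when (lookup P e) (q′ e) + when (lookup Q e) (lo e) ≤
                     when (lookup P e) (q e) + when (lookup Q e) (lo′ e)
        term e with e ≟ i
        ... | yes refl rewrite q′i | qi = at-i
        ... | no e≢i with off e e≢i
        ...   | q′e , lo′e , _ rewrite q′e | lo′e = ≤-refl

      -- Induction on a list covering the swapped coordinates. Raising both `q` and `lo` at such an
      -- `i` to `r i` makes `i` a kept coordinate, so the induction hypothesis applies; `raise` then
      -- undoes the change.
      submodular-on : ∀ (es : List (Fin n)) q r hi lo →
        (∀ e → Kept (q e) (r e) (hi e) (lo e) ⊎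
               (Swapped (q e) (r e) (hi e) (lo e) × e ∈ₗ es)) →
        ∀ {W Z} → dom F W → dom F Z →
        ∃[ U ] ∃[ V ] dom F U × dom F V ×
          score F hi W + score F lo Z ≤ score F q U + score F r V
      submodular-on [] q r hi lo mix {W} {Z} dW dZ =
        W , Z , dW , dZ , score-mono₂ F F W Z W Z ≤-refl term
        where
        term : ∀ e → when (lookup W e) (hi e) + when (lookup Z e) (lo e) ≤
                     when (lookup W e) (q e) + when (lookup Z e) (r e)
        term e with mix e
        ... | inj₁ (hie , loe , _) rewrite hie | loe = ≤-refl
      submodular-on (i ∷ es) q r hi lo mix dW dZ with mix i
      ... | inj₁ kept = submodular-on es q r hi lo mix′ dW dZ
        where
        mix′ : ∀ e → Kept (q e) (r e) (hi e) (lo e) ⊎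
                     (Swapped (q e) (r e) (hi e) (lo e) × e ∈ₗ es)
        mix′ e with mix e
        ... | inj₁ k               = inj₁ k
        ... | inj₂ (_ , here refl) = inj₁ kept
        ... | inj₂ (s , there e∈)  = inj₂ (s , e∈)
      ... | inj₂ ((hii , loi , qi≤ri) , _)
        -- `M` attains the conjugate at the raised `lo`. The set `M′` that `raise` returns is scored
        -- with the same weights, hence no higher, and `M` cancels.
        with maximum (dom F) (score F (updateAt lo i (λ _ → r i))) (_ , dZ)
      ... | M , dM , bound
        with submodular-on es (updateAt q i (λ _ → r i)) r hi (updateAt lo i (λ _ → r i)) mix′ dW dM
        where
        mix′ : ∀ e → Kept (updateAt q i (λ _ → r i) e) (r e) (hi e) (updateAt lo i (λ _ → r i) e) ⊎
          (Swapped (updateAt q i (λ _ → r i) e) (r e) (hi e) (updateAt lo i (λ _ → r i) e) × e ∈ₗ es)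
        mix′ e with e ≟ i
        ... | yes refl
          rewrite updateAt-updates i {λ _ → r i} q | updateAt-updates i {λ _ → r i} lo =
          inj₁ (hii , refl , ≤-refl)
        ... | no e≢i
          rewrite updateAt-minimal e i {λ _ → r i} q e≢i | updateAt-minimal e i {λ _ → r i} lo e≢i
          with mix e
        ...   | inj₁ k               = inj₁ k
        ...   | inj₂ (_ , here e≡i)  = contradiction e≡i e≢i
        ...   | inj₂ (s , there e∈)  = inj₂ (s , e∈)
      ... | U₁ , V , dU₁ , dV , h₁
        with raise i dU₁ dZ
               (trans (updateAt-updates i q) (sym (updateAt-updates i lo)))
               (sym loi)
               (subst₂ _≤_ (sym loi) (sym (updateAt-updates i lo)) qi≤ri)
               (λ e e≢i → updateAt-minimal e i q e≢i , updateAt-minimal e i lo e≢i , lo≤q e)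
        where
        lo≤q : ∀ e → lo e ≤ q e
        lo≤q e with mix e
        ... | inj₁ (_ , loe , re≤qe)   rewrite loe = re≤qe
        ... | inj₂ ((_ , loe , _) , _) rewrite loe = ≤-refl
      ... | U , M′ , dU , dM′ , h₂ = U , V , dU , dV , +-splice h₁ h₂ (bound dM′)

      submodular : (∀ e → Mixed (q e) (r e) (hi e) (lo e)) →
        ∀ {W Z} → dom F W → dom F Z →
        ∃[ U ] ∃[ V ] dom F U × dom F V ×
          score F hi W + score F lo Z ≤ score F q U + score F r V
      submodular mix = submodular-on (allFin n) _ _ _ _ (λ e → Sum.map₂ (_, ∈-allFin e) (mix e))

      -- Submodularity of K ↦ max { value Z + q(Z) : Z \ B = K }, between the
      -- traces of X and Y outside B.
      transfer : ∀ (B : Fin n → Set) q (I : List (Fin n)) {X Y} → dom F X → dom F Y →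
        (∀ e → ¬ B e → lookup Y e ≡ true → lookup X e ≡ true) →
        (∀ e → e ∈ₗ I → ¬ B e × lookup X e ≡ true × lookup Y e ≡ false) →
        ∃[ U ] ∃[ V ] dom F U × dom F V ×
          (∀ e → ¬ B e → (e ∈ₗ I → lookup U e ≡ false × lookup V e ≡ true) ×
                         (e ∉ₗ I → lookup U e ≡ lookup X e × lookup V e ≡ lookup Y e)) ×
          score F q X + score F q Y ≤ score F q U + score F q V
      transfer B q [] {X} {Y} dX dY _ _ =
        X , Y , dX , dY , (λ _ _ → (λ ()) , (λ _ → refl , refl)) , ≤-refl
      transfer B q (i ∷ I) {X} {Y} dX dY Y⊆X I⊆ with em {i ∈ₗ I}
      ... | yes i∈I with transfer B q I dX dY Y⊆X (λ e → I⊆ e ∘ there)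
      ...   | U , V , dU , dV , trace , h = U , V , dU , dV , (λ e ¬Be →
              (λ where (here refl) → proj₁ (trace e ¬Be) i∈I
                       (there e∈I) → proj₁ (trace e ¬Be) e∈I) ,
              (λ e∉ → proj₂ (trace e ¬Be) (e∉ ∘ there))) , h
      transfer B q (i ∷ I) {X} {Y} dX dY Y⊆X I⊆ | no i∉I with I⊆ i (here refl)
      -- `M` is the best set whose trace outside `B` is that of `Y` with `i` added. Exchanging `i`
      -- between `X` and `Y` shows that such a set exists: whatever `Y` gives back lies in `B`,
      -- since outside `B` it is contained in `X`.
      ... | ¬Bi , Xi , Yi with maximum Above (score F q) above
        where
        Above : Subset n → Set
        Above M = dom F M × lookup M i ≡ true ×
          (∀ e → ¬ B e → e ≢ i → lookup M e ≡ lookup Y e)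
        above : ∃ Above
        above with exchange F i dX dY Xi Yi
        ... | _ , Y′ , _ , dY′ , (_ , Y′i , rest) , _ = Y′ , dY′ , Y′i , agree
          where
          agree : ∀ e → ¬ B e → e ≢ i → lookup Y′ e ≡ lookup Y e
          agree e ¬Be e≢i with rest e e≢i
          ... | inj₁ (_ , Y′e)      = Y′e
          ... | inj₂ (Xe , Ye , _) = contradiction (trans (sym Xe) (Y⊆X e ¬Be Ye)) λ ()
      ... | M , (dM , Mi , Me) , bound with transfer B q I dX dM M⊆X I⊆′
        where
        M⊆X : ∀ e → ¬ B e → lookup M e ≡ true → lookup X e ≡ true
        M⊆X e ¬Be Met with e ≟ i
        ... | yes refl = Xi
        ... | no e≢i   = Y⊆X e ¬Be (trans (sym (Me e ¬Be e≢i)) Met)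
        I⊆′ : ∀ e → e ∈ₗ I → ¬ B e × lookup X e ≡ true × lookup M e ≡ false
        I⊆′ e e∈I with I⊆ e (there e∈I)
        ... | ¬Be , Xe , Ye = ¬Be , Xe , trans (Me e ¬Be λ { refl → i∉I e∈I }) Ye
      ... | U₁ , V , dU₁ , dV , trace , h₁
        -- As `i` is not in the rest of the list, `U₁` still contains it. Passing it to `Y` produces
        -- a set `M′` that competes with `M`.
        with exchange-score i dU₁ dY (trans (proj₁ (proj₂ (trace i ¬Bi) i∉I)) Xi) Yi refl
               (λ _ _ → refl , refl , ≤-refl)
      ... | U , M′ , dU , dM′ , (Ui , M′i , rest) , h₂ =
        U , V , dU , dV , trace′ , +-splice h₁ h₂ (bound (dM′ , M′i , λ e ¬Be e≢i → proj₂ (stays e ¬Be e≢i)))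
        where
        stays : ∀ e → ¬ B e → e ≢ i → lookup U e ≡ lookup U₁ e × lookup M′ e ≡ lookup Y e
        stays e ¬Be e≢i with rest e e≢i
        ... | inj₁ stay = stay
        ... | inj₂ (U₁e , Ye , _) with em {e ∈ₗ I}
        ...   | yes e∈I = contradiction (trans (sym Ye) (proj₂ (proj₂ (I⊆ e (there e∈I))))) λ ()
        ...   | no  e∉I = contradiction
                (trans (sym U₁e) (trans (proj₁ (proj₂ (trace e ¬Be) e∉I)) (Y⊆X e ¬Be Ye))) λ ()
        trace′ : ∀ e → ¬ B e →
          (e ∈ₗ i ∷ I → lookup U e ≡ false × lookup V e ≡ true) ×
          (e ∉ₗ i ∷ I → lookup U e ≡ lookup X e × lookup V e ≡ lookup Y e)
        trace′ e ¬Be with e ≟ i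
        ... | yes refl = (λ _ → Ui , trans (proj₂ (proj₂ (trace i ¬Bi) i∉I)) Mi) ,
                         (λ e∉ → contradiction (here refl) e∉)
        ... | no e≢i with stays e ¬Be e≢i | trace e ¬Be
        ...   | Ue , _ | inside , outside =
          (λ where (here e≡i)  → contradiction e≡i e≢i
                   (there e∈I) → trans Ue (proj₁ (inside e∈I)) , proj₂ (inside e∈I)) ,
          (λ e∉ → trans Ue (proj₁ (outside (e∉ ∘ there))) ,
                  trans (proj₂ (outside (e∉ ∘ there))) (Me e ¬Be e≢i))

    -- Redistribution of weights between two functions

    Agree : List (Fin n) → Subset n → Subset n → Set
    Agree es Z₁ Z₂ = ∀ e → e ∈ₗ es → lookup Z₁ e ≡ lookup Z₂ e

    -- On `es`, where the two sets must agree, only the sum of the two weights counts, so it may be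
    -- split differently; elsewhere both weights are fixed.
    BalancedAt : List (Fin n) → Fin n → (q₁ q₂ p₁ p₂ : R) → Set
    BalancedAt es i q₁ q₂ p₁ p₂ = (i ∈ₗ es × q₁ + q₂ ≈ p₁ + p₂) ⊎ (q₁ ≡ p₁ × q₂ ≡ p₂)

    Balanced : List (Fin n) → (q₁ q₂ p₁ p₂ : Vector R n) → Set
    Balanced es q₁ q₂ p₁ p₂ = ∀ i → BalancedAt es i (q₁ i) (q₂ i) (p₁ i) (p₂ i)

    shift-mono : ∀ (p : Vector R n) e {a b} → a ≤ b → ∀ i → shift p e a i ≤ shift p e b i
    shift-mono p e {a} {b} a≤b i with i ≟ e
    ... | yes refl rewrite updateAt-updates e {_+ a} p | updateAt-updates e {_+ b} p = +-monoʳ-≤ (p e) a≤b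
    ... | no i≢e   rewrite updateAt-minimal i e {_+ a} p i≢e | updateAt-minimal i e {_+ b} p i≢e = ≤-refl

    -- The join of q₁, r₁ is paired with the meet of q₂, r₂ and vice versa; on es,
    -- where the sums agree, q₁ ≤ r₁ means r₂ ≤ q₂, so the sums are kept.
    uncross : ∀ {es p₁ p₂ p₁′ p₂′ q₁ q₂ r₁ r₂} →
      (∀ i → p₁ i ≤ p₁′ i) → (∀ i → p₂ i ≤ p₂′ i) →
      (∀ i → i ∈ₗ es → p₁ i ≡ p₁′ i) → (∀ i → i ∈ₗ es → p₂ i ≡ p₂′ i) →
      Balanced es q₁ q₂ p₁ p₂ → Balanced es r₁ r₂ p₁′ p₂′ →
      ∃[ hi₁ ] ∃[ lo₁ ] ∃[ hi₂ ] ∃[ lo₂ ]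
        (∀ i → Mixed (q₁ i) (r₁ i) (hi₁ i) (lo₁ i)) ×
        (∀ i → Mixed (q₂ i) (r₂ i) (hi₂ i) (lo₂ i)) ×
        Balanced es hi₁ lo₂ p₁′ p₂ × Balanced es lo₁ hi₂ p₁ p₂′
    uncross {es} {p₁} {p₂} {p₁′} {p₂′} {q₁} {q₂} {r₁} {r₂} p₁≤ p₂≤ p₁≡ p₂≡ balq balr =
      (λ i → let (h₁ , _) = at i in h₁) ,
      (λ i → let (_ , l₁ , _) = at i in l₁) ,
      (λ i → let (_ , _ , h₂ , _) = at i in h₂) ,
      (λ i → let (_ , _ , _ , l₂ , _) = at i in l₂) ,
      (λ i → let (_ , _ , _ , _ , mix₁ , _) = at i in mix₁) ,
      (λ i → let (_ , _ , _ , _ , _ , mix₂ , _) = at i in mix₂) ,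
      (λ i → let (_ , _ , _ , _ , _ , _ , bal₁₂ , _) = at i in bal₁₂) ,
      (λ i → let (_ , _ , _ , _ , _ , _ , _ , bal₂₁) = at i in bal₂₁)
      where
      At : Fin n → Set
      At i = ∃[ h₁ ] ∃[ l₁ ] ∃[ h₂ ] ∃[ l₂ ]
        Mixed (q₁ i) (r₁ i) h₁ l₁ × Mixed (q₂ i) (r₂ i) h₂ l₂ ×
        BalancedAt es i h₁ l₂ (p₁′ i) (p₂ i) × BalancedAt es i l₁ h₂ (p₁ i) (p₂′ i)

      antitone : ∀ {x y u v s} → x + y ≈ s → u + v ≈ s → x ≤ u → v ≤ y
      antitone {x} {y} {u} {v} {s} x+y u+v x≤u = +-cancelʳ-≤ u (begin
        v + u  ≈⟨ solve 2 (λ u v → v :+ u ⊜ u :+ v) ≈.refl u v ⟩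
        u + v  ≈⟨ ≈.trans u+v (≈.sym x+y) ⟩
        x + y  ≤⟨ +-monoˡ-≤ y x≤u ⟩
        u + y  ≈⟨ solve 2 (λ u y → u :+ y ⊜ y :+ u) ≈.refl u y ⟩
        y + u  ∎)

      sum : ∀ {q₁ q₂ p₁ p₂ i} → BalancedAt es i q₁ q₂ p₁ p₂ → q₁ + q₂ ≈ p₁ + p₂
      sum (inj₁ (_ , eq))       = eq
      sum (inj₂ (refl , refl)) = ≈.refl

      at : ∀ i → At i
      at i with em {i ∈ₗ es}
      -- Off `es` all weights are prescribed, and the primed ones are at least the others, so `r`
      -- supplies both joins.
      at i | no i∉ with balq i | balr i
      ... | inj₁ (i∈ , _) | _             = contradiction i∈ i∉
      ... | inj₂ _        | inj₁ (i∈ , _) = contradiction i∈ i∉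
      ... | inj₂ (q₁i , q₂i) | inj₂ (r₁i , r₂i) =
        r₁ i , q₁ i , r₂ i , q₂ i ,
        inj₂ (refl , refl , subst₂ _≤_ (sym q₁i) (sym r₁i) (p₁≤ i)) ,
        inj₂ (refl , refl , subst₂ _≤_ (sym q₂i) (sym r₂i) (p₂≤ i)) ,
        inj₂ (r₁i , q₂i) , inj₂ (q₁i , r₂i)
      at i | yes i∈ with sum (balq i) | sum (balr i)
      ... | sumq | sumr rewrite p₁≡ i i∈ | p₂≡ i i∈ with total (q₁ i) (r₁ i)
      ...   | inj₁ q≤r = r₁ i , q₁ i , q₂ i , r₂ i ,
        inj₂ (refl , refl , q≤r) , inj₁ (refl , refl , antitone sumq sumr q≤r) ,
        inj₁ (i∈ , sumr) , inj₁ (i∈ , sumq)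
      ...   | inj₂ r≤q = q₁ i , r₁ i , r₂ i , q₂ i ,
        inj₁ (refl , refl , r≤q) , inj₂ (refl , refl , antitone sumr sumq r≤q) ,
        inj₁ (i∈ , sumq) , inj₁ (i∈ , sumr)


    -- Strong duality by weight splitting

    module Duality (F₁ F₂ : Valuated n) where

      joint : (p₁ p₂ : Vector R n) → Subset n × Subset n → R
      joint p₁ p₂ (Z₁ , Z₂) = score F₁ p₁ Z₁ + score F₂ p₂ Z₂

      Feasible : List (Fin n) → Subset n × Subset n → Set
      Feasible es (Z₁ , Z₂) = dom F₁ Z₁ × dom F₂ Z₂ × Agree es Z₁ Z₂

      -- A dual solution is a splitting under which even independently chosen sets stay strictly
      -- below `c`. It refutes the primal alternative, because pairs that agree on `es` have the
      -- same joint score under every splitting.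
      Primal Dual : List (Fin n) → (p₁ p₂ : Vector R n) → R → Set
      Primal es p₁ p₂ c = ∃[ Z ] Feasible es Z × c ≤ joint p₁ p₂ Z
      Dual   es p₁ p₂ c = ∃[ q₁ ] ∃[ q₂ ] Balanced es q₁ q₂ p₁ p₂ ×
        (∀ {U V} → dom F₁ U → dom F₂ V → ¬ c ≤ joint q₁ q₂ (U , V))

      joint-balanced : ∀ {es q₁ q₂ p₁ p₂} → Balanced es q₁ q₂ p₁ p₂ → ∀ {Z₁ Z₂} →
        Agree es Z₁ Z₂ → joint q₁ q₂ (Z₁ , Z₂) ≈ joint p₁ p₂ (Z₁ , Z₂)
      joint-balanced {es} {q₁} {q₂} {p₁} {p₂} bal {Z₁} {Z₂} agree = IsTotalOrder.antisym isTotalOrder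
        (score-mono₂ F₁ F₂ Z₁ Z₂ Z₁ Z₂ ≤-refl (≤-reflexive ∘ term))
        (score-mono₂ F₁ F₂ Z₁ Z₂ Z₁ Z₂ ≤-refl (≤-reflexive ∘ ≈.sym ∘ term))
        where
        when₂ : ∀ b {x y z w} → x + y ≈ z + w → when b x + when b y ≈ when b z + when b w
        when₂ true  eq = eq
        when₂ false _  = ≈.refl
        term : ∀ e → when (lookup Z₁ e) (q₁ e) + when (lookup Z₂ e) (q₂ e) ≈
                     when (lookup Z₁ e) (p₁ e) + when (lookup Z₂ e) (p₂ e)
        term e with bal e
        ... | inj₁ (e∈ , eq) rewrite agree e e∈ = when₂ (lookup Z₂ e) eq
        ... | inj₂ (q₁e , q₂e) rewrite q₁e | q₂e = ≈.refl

      joint-shift : ∀ p₁ p₂ e a b Z₁ Z₂ →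
        joint (shift p₁ e a) (shift p₂ e b) (Z₁ , Z₂) ≈
        joint p₁ p₂ (Z₁ , Z₂) + (when (lookup Z₁ e) a + when (lookup Z₂ e) b)
      joint-shift p₁ p₂ e a b Z₁ Z₂ = ≈.trans
        (+-cong (+-cong ≈.refl (weight-shift p₁ e a Z₁)) (+-cong ≈.refl (weight-shift p₂ e b Z₂)))
        (solve 6 (λ u x y v z w → (u :+ (x :+ y)) :+ (v :+ (z :+ w)) ⊜ ((u :+ x) :+ (v :+ z)) :+ (y :+ w))
          ≈.refl _ _ _ _ _ _)

      -- Induction step: one more coordinate of agreement

      module Step (e : Fin n) (es : List (Fin n)) (e∉es : e ∉ₗ es)
        (IH : ∀ p₁ p₂ c → Primal es p₁ p₂ c ⊎ Dual es p₁ p₂ c)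
        (p₁ p₂ : Vector R n) (c : R)
        (¬primal : ¬ Primal (e ∷ es) p₁ p₂ c) (¬dual : ¬ Dual (e ∷ es) p₁ p₂ c) where

        level : Subset n × Subset n → R
        level = joint p₁ p₂

        Split : Bool → Bool → Subset n × Subset n → Set
        Split b₁ b₂ Z@(Z₁ , Z₂) = Feasible es Z × lookup Z₁ e ≡ b₁ × lookup Z₂ e ≡ b₂

        below : ∀ {b Z} → Split b b Z → ¬ c ≤ level Z
        below {b} {Z} ((d₁ , d₂ , agree) , Z₁e , Z₂e) c≤ = ¬primal (Z , (d₁ , d₂ , agree′) , c≤)
          where
          agree′ : Agree (e ∷ es) (proj₁ Z) (proj₂ Z)
          agree′ _ (here refl)  = trans Z₁e (sym Z₂e)
          agree′ i (there i∈es) = agree i i∈es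

        Bound : R → R → R → Set
        Bound a b m = ∃[ b₁ ] ∃[ b₂ ] ∃[ Z ] Split b₁ b₂ Z × m ≤ level Z + (when b₁ a + when b₂ b)

        primal-shift : ∀ {a b m} → Primal es (shift p₁ e a) (shift p₂ e b) m → Bound a b m
        primal-shift {a} {b} (Z@(Z₁ , Z₂) , feas , m≤) =
          _ , _ , Z , (feas , refl , refl) , ≤-trans m≤ (≤-reflexive (joint-shift p₁ p₂ e a b Z₁ Z₂))

        -- Since `a + b` is zero, a dual solution for the shifted weights would also be one for
        -- `e ∷ es`. So some pair reaches `c` after the shift, and it must disagree at `e`: pairs
        -- that agree there gain nothing and stay below `c`.
        off-diagonal : ∀ a b → a + b ≈ 0# →
          (∃[ Z ] Split false true Z × c ≤ level Z + b) ⊎ (∃[ Z ] Split true false Z × c ≤ level Z + a)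
        off-diagonal a b a+b≈0 with IH (shift p₁ e a) (shift p₂ e b) c
        ... | inj₂ (q₁ , q₂ , bal , low) = contradiction (q₁ , q₂ , bal′ , λ {U} {V} → low {U} {V}) ¬dual
          where
          bal′ : Balanced (e ∷ es) q₁ q₂ p₁ p₂
          bal′ i with i ≟ e | bal i
          ... | no i≢e   | inj₁ (i∈ , eq) rewrite updateAt-minimal i e {_+ a} p₁ i≢e | updateAt-minimal i e {_+ b} p₂ i≢e =
            inj₁ (there i∈ , eq)
          ... | no i≢e   | inj₂ eqs rewrite updateAt-minimal i e {_+ a} p₁ i≢e | updateAt-minimal i e {_+ b} p₂ i≢e =
            inj₂ eqs
          ... | yes refl | inj₁ (i∈ , _) = contradiction i∈ e∉es
          ... | yes refl | inj₂ (q₁e , q₂e) rewrite q₁e | q₂e | updateAt-updates e {_+ a} p₁ | updateAt-updates e {_+ b} p₂ =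
            inj₁ (here refl , ≈.trans (+-interchange _ _ _ _)
              (≈.trans (+-cong ≈.refl a+b≈0) (+-identityʳ _)))
        ... | inj₁ primal with primal-shift {a} {b} primal
        ...   | false , false , Z , split , c≤ =
          contradiction (≤-trans c≤ (≤-reflexive (solve 1 (λ x → x :+ (id :+ id) ⊜ x) ≈.refl _))) (below split)
        ...   | true , true , Z , split , c≤ =
          contradiction (≤-trans c≤ (≤-reflexive (≈.trans (+-cong ≈.refl a+b≈0) (+-identityʳ _)))) (below split)
        ...   | false , true , Z , split , c≤ =
          inj₁ (Z , split , ≤-trans c≤ (≤-reflexive (solve 2 (λ x y → x :+ (id :+ y) ⊜ x :+ y) ≈.refl _ _)))
        ...   | true , false , Z , split , c≤ =
          inj₂ (Z , split , ≤-trans c≤ (≤-reflexive (solve 2 (λ x y → x :+ (y :+ id) ⊜ x :+ y) ≈.refl _ _)))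

        -- The amount `d` is so negative that even the largest level of all pairs stays below `c`
        -- after adding it. Charging `d` to one kind of disagreement forces `off-diagonal` to return
        -- the other kind.
        splits : (∃ (Split false true)) × (∃ (Split true false))
        splits = first , second
          where
          some : ∃ (Feasible [])
          some with off-diagonal 0# 0# (+-identityʳ 0#)
          ... | inj₁ (Z , ((d₁ , d₂ , _) , _) , _) = Z , d₁ , d₂ , λ _ ()
          ... | inj₂ (Z , ((d₁ , d₂ , _) , _) , _) = Z , d₁ , d₂ , λ _ ()
          top = maximum₂ (Feasible []) level some
          d : R
          d = proj₁ (escape c (level (proj₁ top)))
          d⁻ : R
          d⁻ = proj₁ (negative d)
          too-low : ∀ {b₁ b₂ Z} → Split b₁ b₂ Z → ¬ c ≤ level Z + d
          too-low ((d₁ , d₂ , _) , _) c≤ = proj₂ (escape c (level (proj₁ top)))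
            (≤-trans c≤ (+-monoˡ-≤ d (proj₂ (proj₂ top) (d₁ , d₂ , λ _ ()))))
          first : ∃ (Split false true)
          first with off-diagonal d d⁻ (proj₂ (negative d))
          ... | inj₁ (Z , split , _)  = Z , split
          ... | inj₂ (_ , split , c≤) = contradiction c≤ (too-low split)
          second : ∃ (Split true false)
          second with off-diagonal d⁻ d (≈.trans (+-comm d⁻ d) (proj₂ (negative d)))
          ... | inj₂ (Z , split , _)  = Z , split
          ... | inj₁ (_ , split , c≤) = contradiction c≤ (too-low split)

        impossible : ⊥
        impossible with splits
        ... | someX , someY
          with maximum₂ (Split false true) level someX | maximum₂ (Split true false) level someY
        ... | X , splitX@((dX₁ , dX₂ , agreeX) , X₁e , X₂e) , maxX
            | Y , splitY@((dY₁ , dY₂ , agreeY) , Y₁e , Y₂e) , maxY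
          with equalise (level X) (level Y) | negative 1#
        ... | a , b , a+b≈0 , x+b≈y+a | ν , 1+ν≈0 = conclude
          -- Here `ν` is -1. After lowering, disagreeing pairs reach at most m - 1; after raising,
          -- at most m + 1. Pairs that agree at `e` have level below m and change by 0 or by twice
          -- the shift. So neither target, m or m + 2, is attained, and both dual solutions exist.
          (no-primal (IH (shift p₁ e (a + ν)) (shift p₂ e (b + ν)) m) below-down)
          (no-primal (IH (shift p₁ e (a + 1#)) (shift p₂ e (b + 1#)) (m + (1# + 1#))) below-up)
          where
          m : R
          m = level X + b

          no-primal : ∀ {p₁ p₂ c} → Primal es p₁ p₂ c ⊎ Dual es p₁ p₂ c →
            ¬ Primal es p₁ p₂ c → Dual es p₁ p₂ c
          no-primal (inj₁ primal) ¬primal = contradiction primal ¬primal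
          no-primal (inj₂ dual)   _       = dual

          -- The equalising shift gives both kinds of disagreement the maximum `m`, and by
          -- `off-diagonal` one of them reaches `c`.
          c≤m : c ≤ m
          c≤m with off-diagonal a b a+b≈0
          ... | inj₁ (_ , split , c≤) = ≤-trans c≤ (+-monoˡ-≤ b (maxX split))
          ... | inj₂ (_ , split , c≤) =
            ≤-trans c≤ (≤-trans (+-monoˡ-≤ a (maxY split)) (≤-reflexive (≈.sym x+b≈y+a)))

          0≤1 : 0# ≤ 1#
          0≤1 = [ (λ le → le) , (λ le → contradiction le 1≰0) ]′ (total 0# 1#)

          below-m : ∀ {b Z} → Split b b Z → ¬ m ≤ level Z
          below-m split m≤ = below split (≤-trans c≤m m≤)

          x+1≰x : ∀ {x} → ¬ x + 1# ≤ x
          x+1≰x {x} x+1≤x = 1≰0 (+-cancelʳ-≤ x (begin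
            1# + x  ≈⟨ solve 2 (λ i x → i :+ x ⊜ x :+ i) ≈.refl 1# x ⟩
            x + 1#  ≤⟨ x+1≤x ⟩
            x       ≈⟨ solve 1 (λ x → x ⊜ id :+ x) ≈.refl x ⟩
            0# + x  ∎))

          x≰x+ν : ∀ {x} → ¬ x ≤ x + ν
          x≰x+ν {x} x≤x+ν = x+1≰x (begin
            x + 1#          ≤⟨ +-monoˡ-≤ 1# x≤x+ν ⟩
            (x + ν) + 1#    ≈⟨ solve 3 (λ x ν i → (x :+ ν) :+ i ⊜ x :+ (i :+ ν)) ≈.refl x ν 1# ⟩
            x + (1# + ν)    ≈⟨ +-cong ≈.refl 1+ν≈0 ⟩
            x + 0#          ≈⟨ +-identityʳ x ⟩
            x               ∎)

          diagonal : ∀ l t → l + ((a + t) + (b + t)) ≈ l + (t + t)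
          diagonal l t = begin-equality
            l + ((a + t) + (b + t))  ≈⟨ solve 4 (λ l a b t → l :+ ((a :+ t) :+ (b :+ t)) ⊜ (l :+ (t :+ t)) :+ (a :+ b)) ≈.refl l a b t ⟩
            (l + (t + t)) + (a + b)  ≈⟨ +-cong ≈.refl a+b≈0 ⟩
            (l + (t + t)) + 0#       ≈⟨ +-identityʳ _ ⟩
            l + (t + t)              ∎

          off₁ : ∀ {Z} t → Split false true Z → level Z + (0# + (b + t)) ≤ m + t
          off₁ {Z} t split = begin
            level Z + (0# + (b + t))  ≤⟨ +-monoˡ-≤ _ (maxX split) ⟩
            level X + (0# + (b + t))  ≈⟨ solve 3 (λ x b t → x :+ (id :+ (b :+ t)) ⊜ (x :+ b) :+ t) ≈.refl (level X) b t ⟩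
            m + t                     ∎

          off₂ : ∀ {Z} t → Split true false Z → level Z + ((a + t) + 0#) ≤ m + t
          off₂ {Z} t split = begin
            level Z + ((a + t) + 0#)  ≤⟨ +-monoˡ-≤ _ (maxY split) ⟩
            level Y + ((a + t) + 0#)  ≈⟨ solve 3 (λ y a t → y :+ ((a :+ t) :+ id) ⊜ (y :+ a) :+ t) ≈.refl (level Y) a t ⟩
            (level Y + a) + t         ≈⟨ +-cong x+b≈y+a ≈.refl ⟨
            m + t                     ∎

          ν≤0 : ν ≤ 0#
          ν≤0 = [ (λ le → le) , (λ le → contradiction (begin
            1#       ≈⟨ +-identityʳ 1# ⟨
            1# + 0#  ≤⟨ +-monoʳ-≤ 1# le ⟩
            1# + ν   ≈⟨ 1+ν≈0 ⟩
            0#       ∎) 1≰0) ]′ (total ν 0#)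

          below-down : ¬ Primal es (shift p₁ e (a + ν)) (shift p₂ e (b + ν)) m
          below-down primal with primal-shift {a + ν} {b + ν} primal
          ... | false , true , Z , split , m≤ = x≰x+ν (≤-trans m≤ (off₁ ν split))
          ... | true , false , Z , split , m≤ = x≰x+ν (≤-trans m≤ (off₂ ν split))
          ... | false , false , Z , split , m≤ = below-m split (begin
            m                       ≤⟨ m≤ ⟩
            level Z + (0# + 0#)     ≈⟨ solve 1 (λ x → x :+ (id :+ id) ⊜ x) ≈.refl (level Z) ⟩
            level Z                 ∎)
          ... | true , true , Z , split , m≤ = below-m split (begin
            m                                  ≤⟨ m≤ ⟩
            level Z + ((a + ν) + (b + ν))      ≈⟨ diagonal (level Z) ν ⟩
            level Z + (ν + ν)                  ≤⟨ +-monoʳ-≤ (level Z) (+-mono-≤ ν≤0 ν≤0) ⟩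
            level Z + (0# + 0#)                ≈⟨ solve 1 (λ x → x :+ (id :+ id) ⊜ x) ≈.refl (level Z) ⟩
            level Z                            ∎)

          below-up : ¬ Primal es (shift p₁ e (a + 1#)) (shift p₂ e (b + 1#)) (m + (1# + 1#))
          below-up primal with primal-shift {a + 1#} {b + 1#} primal
          ... | false , true , Z , split , m≤ = x+1≰x (begin
            (m + 1#) + 1#         ≈⟨ solve 2 (λ m i → (m :+ i) :+ i ⊜ m :+ (i :+ i)) ≈.refl m 1# ⟩
            m + (1# + 1#)         ≤⟨ ≤-trans m≤ (off₁ 1# split) ⟩
            m + 1#                ∎)
          ... | true , false , Z , split , m≤ = x+1≰x (begin
            (m + 1#) + 1#         ≈⟨ solve 2 (λ m i → (m :+ i) :+ i ⊜ m :+ (i :+ i)) ≈.refl m 1# ⟩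
            m + (1# + 1#)         ≤⟨ ≤-trans m≤ (off₂ 1# split) ⟩
            m + 1#                ∎)
          ... | false , false , Z , split , m≤ = below-m split (begin
            m                       ≈⟨ solve 1 (λ x → x ⊜ x :+ (id :+ id)) ≈.refl m ⟩
            m + (0# + 0#)           ≤⟨ +-monoʳ-≤ m (+-mono-≤ 0≤1 0≤1) ⟩
            m + (1# + 1#)           ≤⟨ m≤ ⟩
            level Z + (0# + 0#)     ≈⟨ solve 1 (λ x → x :+ (id :+ id) ⊜ x) ≈.refl (level Z) ⟩
            level Z                 ∎)
          ... | true , true , Z , split , m≤ =
            below-m split (+-cancelʳ-≤ (1# + 1#) (≤-trans m≤ (≤-reflexive (diagonal (level Z) 1#))))

          p₁≤ : ∀ i → shift p₁ e (a + ν) i ≤ shift p₁ e (a + 1#) i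
          p₁≤ = shift-mono p₁ e (+-monoʳ-≤ a (≤-trans ν≤0 0≤1))

          p₂≤ : ∀ i → shift p₂ e (b + ν) i ≤ shift p₂ e (b + 1#) i
          p₂≤ = shift-mono p₂ e (+-monoʳ-≤ b (≤-trans ν≤0 0≤1))

          conclude : Dual es (shift p₁ e (a + ν)) (shift p₂ e (b + ν)) m →
            Dual es (shift p₁ e (a + 1#)) (shift p₂ e (b + 1#)) (m + (1# + 1#)) → ⊥
          conclude (q₁ , q₂ , balq , lowq) (r₁ , r₂ , balr , lowr)
            with uncross p₁≤ p₂≤ (shift-eq p₁) (shift-eq p₂) balq balr
            where
            shift-eq : ∀ p {a b} i → i ∈ₗ es → shift p e a i ≡ shift p e b i
            shift-eq p i i∈ = trans (updateAt-minimal i e p i≢e) (sym (updateAt-minimal i e p i≢e))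
              where
              i≢e : i ≢ e
              i≢e refl = e∉es i∈
          ... | hi₁ , lo₁ , hi₂ , lo₂ , mix₁ , mix₂ , bal , bal′
            -- `Y` has `e` in its first set only and `X` in its second only, so the pairing of `hi₁`
            -- with `lo₂` on `Y`, and of `lo₁` with `hi₂` on `X`, lets each pair collect the raised
            -- weight at `e` and have value m + 1.
            with submodular F₁ mix₁ dY₁ dX₁ | submodular F₂ mix₂ dX₂ dY₂
          ... | U₁ , V₁ , dU₁ , dV₁ , h₁ | U₂ , V₂ , dU₂ , dV₂ , h₂ =
            lowq dU₁ dU₂ (+-cancelʳ-≤ (m + (1# + 1#)) (begin
              m + (m + (1# + 1#))
                ≈⟨ solve 2 (λ m i → m :+ (m :+ (i :+ i)) ⊜ (m :+ i) :+ (m :+ i)) ≈.refl m 1# ⟩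
              (m + 1#) + (m + 1#)
                ≈⟨ +-cong atY atX ⟨
              joint hi₁ lo₂ Y + joint lo₁ hi₂ X
                ≈⟨ solve 4 (λ s t u v → (s :+ t) :+ (u :+ v) ⊜ (s :+ u) :+ (v :+ t)) ≈.refl _ _ _ _ ⟩
              (score F₁ hi₁ (proj₁ Y) + score F₁ lo₁ (proj₁ X)) +
              (score F₂ hi₂ (proj₂ X) + score F₂ lo₂ (proj₂ Y))
                ≤⟨ +-mono-≤ h₁ h₂ ⟩
              (score F₁ q₁ U₁ + score F₁ r₁ V₁) + (score F₂ q₂ U₂ + score F₂ r₂ V₂)
                ≈⟨ +-interchange _ _ _ _ ⟩
              joint q₁ q₂ (U₁ , U₂) + joint r₁ r₂ (V₁ , V₂)
                -- The values for `q` and `r` total at least 2m + 2, and the one for `r` is below m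
                -- + 2, so the one for `q` reaches m, against `lowq`.
                ≤⟨ +-monoʳ-≤ _ ([ (λ le → le) , (λ le → contradiction le (lowr dV₁ dV₂)) ]′ (total _ _)) ⟩
              joint q₁ q₂ (U₁ , U₂) + (m + (1# + 1#))
                ∎))
            where
            atY : joint hi₁ lo₂ Y ≈ m + 1#
            atY = begin-equality
              joint hi₁ lo₂ Y
                ≈⟨ joint-balanced bal agreeY ⟩
              joint (shift p₁ e (a + 1#)) (shift p₂ e (b + ν)) Y
                ≈⟨ joint-shift p₁ p₂ e (a + 1#) (b + ν) _ _ ⟩
              level Y + (when (lookup (proj₁ Y) e) (a + 1#) + when (lookup (proj₂ Y) e) (b + ν))
                ≡⟨ cong₂ (λ s t → level Y + (when s (a + 1#) + when t (b + ν))) Y₁e Y₂e ⟩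
              level Y + ((a + 1#) + 0#)
                ≈⟨ solve 3 (λ y a i → y :+ ((a :+ i) :+ id) ⊜ (y :+ a) :+ i) ≈.refl (level Y) a 1# ⟩
              (level Y + a) + 1#
                ≈⟨ +-cong x+b≈y+a ≈.refl ⟨
              m + 1#
                ∎
            atX : joint lo₁ hi₂ X ≈ m + 1#
            atX = begin-equality
              joint lo₁ hi₂ X
                ≈⟨ joint-balanced bal′ agreeX ⟩
              joint (shift p₁ e (a + ν)) (shift p₂ e (b + 1#)) X
                ≈⟨ joint-shift p₁ p₂ e (a + ν) (b + 1#) _ _ ⟩
              level X + (when (lookup (proj₁ X) e) (a + ν) + when (lookup (proj₂ X) e) (b + 1#))
                ≡⟨ cong₂ (λ s t → level X + (when s (a + ν) + when t (b + 1#))) X₁e X₂e ⟩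
              level X + (0# + (b + 1#))
                ≈⟨ solve 3 (λ x b i → x :+ (id :+ (b :+ i)) ⊜ (x :+ b) :+ i) ≈.refl (level X) b 1# ⟩
              m + 1#
                ∎

      -- With nothing to agree on, the given weights are themselves a dual solution as soon as no
      -- pair reaches `c`. A coordinate already listed adds no constraint; a new one is handled by
      -- `Step`.
      duality : ∀ es p₁ p₂ c → Primal es p₁ p₂ c ⊎ Dual es p₁ p₂ c
      duality [] p₁ p₂ c with em {Primal [] p₁ p₂ c}
      ... | yes primal = inj₁ primal
      ... | no ¬primal = inj₂ (p₁ , p₂ , (λ _ → inj₂ (refl , refl)) ,
              λ d₁ d₂ c≤ → ¬primal (_ , (d₁ , d₂ , λ _ ()) , c≤))
      duality (e ∷ es) p₁ p₂ c with em {Primal (e ∷ es) p₁ p₂ c} | em {Dual (e ∷ es) p₁ p₂ c}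
      ... | yes primal | _        = inj₁ primal
      ... | no _       | yes dual = inj₂ dual
      ... | no ¬primal | no ¬dual with em {e ∈ₗ es}
      ...   | no e∉es = contradiction (Step.impossible e es e∉es (duality es) p₁ p₂ c ¬primal ¬dual) λ ()
      ...   | yes e∈es with duality es p₁ p₂ c
      ...     | inj₁ (Z , (d₁ , d₂ , agree) , c≤) = inj₁ (Z , (d₁ , d₂ , λ where
                  i (here refl) → agree i e∈es
                  i (there i∈)  → agree i i∈) , c≤)
      ...     | inj₂ (q₁ , q₂ , bal , low) = inj₂ (q₁ , q₂ , bal′ , λ {U} {V} → low {U} {V})
        where
        bal′ : Balanced (e ∷ es) q₁ q₂ p₁ p₂
        bal′ i with bal i
        ... | inj₁ (i∈ , eq) = inj₁ (there i∈ , eq)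
        ... | inj₂ eqs       = inj₂ eqs

    -- Restriction and complementation

    restrict : (Fin n → Set) → (Fin n → Bool) → Valuated n → Valuated n
    restrict B K F = record
      { dom      = λ Z → dom F Z × (∀ e → ¬ B e → lookup Z e ≡ K e)
      ; value    = value F
      ; exchange = restricted }
      where
      restricted : ∀ {P Q} i → dom F P × (∀ e → ¬ B e → lookup P e ≡ K e) →
        dom F Q × (∀ e → ¬ B e → lookup Q e ≡ K e) → lookup P i ≡ true → lookup Q i ≡ false →
        ∃[ P′ ] ∃[ Q′ ] (dom F P′ × (∀ e → ¬ B e → lookup P′ e ≡ K e)) ×
          (dom F Q′ × (∀ e → ¬ B e → lookup Q′ e ≡ K e)) × Moved i P Q P′ Q′ ×
          value F P + value F Q ≤ value F P′ + value F Q′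
      restricted {P} {Q} i (dP , traceP) (dQ , traceQ) Pi Qi with exchange F i dP dQ Pi Qi
      ... | P′ , Q′ , dP′ , dQ′ , moved@(_ , _ , rest) , v =
        P′ , Q′ , (dP′ , λ e → proj₁ ∘ traces e) , (dQ′ , λ e → proj₂ ∘ traces e) , moved , v
        where
        -- Both sets have trace `K` outside `B`, so an exchange between them can touch only elements
        -- of `B`, and the traces survive it.
        clash : ∀ {e b} → ¬ B e → lookup P e ≡ b → lookup Q e ≡ not b → ⊥
        clash {e} {true}  ¬Be Pe Qe with trans (sym Pe) (trans (traceP e ¬Be) (trans (sym (traceQ e ¬Be)) Qe))
        ... | ()
        clash {e} {false} ¬Be Pe Qe with trans (sym Pe) (trans (traceP e ¬Be) (trans (sym (traceQ e ¬Be)) Qe))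
        ... | ()
        traces : ∀ e → ¬ B e → lookup P′ e ≡ K e × lookup Q′ e ≡ K e
        traces e ¬Be with e ≟ i
        ... | yes refl = contradiction Qi (clash ¬Be Pi)
        ... | no e≢i with rest e e≢i
        ...   | inj₁ (P′e , Q′e)    = trans P′e (traceP e ¬Be) , trans Q′e (traceQ e ¬Be)
        ...   | inj₂ (Pe , Qe , _) = contradiction Qe (clash ¬Be Pe)

    ∁-involutive : (Z : Subset n) → ∁ (∁ Z) ≡ Z
    ∁-involutive Z = trans (sym (map-∘ not not Z)) (trans (map-cong not-involutive Z) (map-id Z))

    lookup-∁ : ∀ (Z : Subset n) e {b} → lookup Z e ≡ b → lookup (∁ Z) e ≡ not b
    lookup-∁ Z e Ze = trans (lookup-map e not Z) (cong not Ze)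

    -- The relaxed exchange property is self-dual: complementation interchanges the roles of the two
    -- sets, so `i` is passed from the complement of `Q` to that of `P`.
    complement : Valuated n → Valuated n
    complement F = record
      { dom      = dom F ∘ ∁
      ; value    = value F ∘ ∁
      ; exchange = complemented }
      where
      complemented : ∀ {P Q} i → dom F (∁ P) → dom F (∁ Q) → lookup P i ≡ true → lookup Q i ≡ false →
        ∃[ P′ ] ∃[ Q′ ] dom F (∁ P′) × dom F (∁ Q′) × Moved i P Q P′ Q′ ×
          value F (∁ P) + value F (∁ Q) ≤ value F (∁ P′) + value F (∁ Q′)
      complemented {P} {Q} i dP dQ Pi Qi
        with exchange F i dQ dP (lookup-∁ Q i Qi) (lookup-∁ P i Pi)
      ... | Q′ , P′ , dQ′ , dP′ , (Q′i , P′i , rest) , v =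
        ∁ P′ , ∁ Q′ ,
        subst (dom F) (sym (∁-involutive P′)) dP′ ,
        subst (dom F) (sym (∁-involutive Q′)) dQ′ ,
        (lookup-∁ P′ i P′i , lookup-∁ Q′ i Q′i , moved) , (begin
          value F (∁ P) + value F (∁ Q)
            ≈⟨ solve 2 (λ p q → p :+ q ⊜ q :+ p) ≈.refl _ _ ⟩
          value F (∁ Q) + value F (∁ P)
            ≤⟨ v ⟩
          value F Q′ + value F P′
            ≈⟨ solve 2 (λ p q → p :+ q ⊜ q :+ p) ≈.refl _ _ ⟩
          value F P′ + value F Q′
            ≡⟨ cong₂ (λ P Q → value F P + value F Q) (∁-involutive P′) (∁-involutive Q′) ⟨
          value F (∁ (∁ P′)) + value F (∁ (∁ Q′))
            ∎)
        where
        flip : ∀ (Z Z′ : Subset n) e → lookup Z′ e ≡ lookup (∁ Z) e → lookup (∁ Z′) e ≡ lookup Z e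
        flip Z Z′ e eq = trans (lookup-∁ Z′ e eq)
          (trans (cong not (lookup-map e not Z)) (not-involutive _))
        unflip : ∀ (Z : Subset n) e {b} → lookup (∁ Z) e ≡ b → lookup Z e ≡ not b
        unflip Z e eq = trans (sym (not-involutive _)) (cong not (trans (sym (lookup-map e not Z)) eq))
        moved : ∀ e → e ≢ i →
          (lookup (∁ P′) e ≡ lookup P e × lookup (∁ Q′) e ≡ lookup Q e) ⊎
          (lookup P e ≡ false × lookup Q e ≡ true × lookup (∁ P′) e ≡ true × lookup (∁ Q′) e ≡ false)
        moved e e≢i with rest e e≢i
        ... | inj₁ (Q′e , P′e)           = inj₁ (flip P P′ e P′e , flip Q Q′ e Q′e)
        ... | inj₂ (Qe , Pe , Q′e , P′e) =
          inj₂ (unflip P e Pe , unflip Q e Qe , lookup-∁ P′ e P′e , lookup-∁ Q′ e Q′e)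

    -- Multiple exchange as an instance of duality

    multiple-exchange : ∀ (F : Valuated n) X Y I → dom F X → dom F Y →
      (∀ e → lookup I e ≡ true → lookup X e ≡ true × lookup Y e ≡ false) →
      ∃[ Z ] ∃[ W ] dom F Z × dom F W ×
        (∀ e → Cell (lookup X e) (lookup Y e) (lookup I e) (lookup Z e) (lookup W e)) ×
        value F X + value F Y ≤ value F Z + value F W
    multiple-exchange F X Y I dX dY I⊆ = conclude (duality es (λ _ → 0#) (λ _ → 0#) c)
      where
      B : Fin n → Set
      B e = lookup Y e ≡ true × lookup X e ≡ false
      es is : List (Fin n)
      es = filter (λ e → em {B e}) (allFin n)
      is = filter (λ e → em {lookup I e ≡ true}) (allFin n)
      c : R
      c = value F X + value F Y
      K₁ K₂ : Fin n → Bool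
      K₁ e = if lookup I e then false else lookup X e
      K₂ e = if lookup I e then true else lookup Y e
      -- Outside `B` the traces are those of X minus I and of Y together with I. Because `F₂` is
      -- complemented, agreement on `B` says that the second set keeps exactly the elements of `B`
      -- that the first does not take.
      F₁ F₂ : Valuated n
      F₁ = restrict B K₁ F
      F₂ = complement (restrict B K₂ F)
      open Duality F₁ F₂

      ∈es⇒B : ∀ {e} → e ∈ₗ es → B e
      ∈es⇒B {e} e∈ = proj₂ (∈-filter⁻ (λ e → em {B e}) {e} {allFin n} e∈)

      ∈is⇒I : ∀ {e} → e ∈ₗ is → lookup I e ≡ true
      ∈is⇒I {e} e∈ = proj₂ (∈-filter⁻ (λ e → em {lookup I e ≡ true}) {e} {allFin n} e∈)

      I⇒∈is : ∀ {e} → lookup I e ≡ true → e ∈ₗ is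
      I⇒∈is Ie = ∈-filter⁺ (λ e → em {lookup I e ≡ true}) (∈-allFin _) Ie

      cell : ∀ e {z w} → (B e → w ≡ not z) → (¬ B e → z ≡ K₁ e) → (¬ B e → w ≡ K₂ e) →
        Cell (lookup X e) (lookup Y e) (lookup I e) z w
      cell e onB off₁ off₂ with em {B e}
      ... | yes Be@(Ye , Xe) = inj₁ (Ye , Xe , onB Be)
      ... | no ¬Be with off₁ ¬Be | off₂ ¬Be
      ...   | z≡ | w≡ with lookup I e
      ...     | true  = inj₂ (¬Be , inj₁ (refl , z≡ , w≡))
      ...     | false = inj₂ (¬Be , inj₂ (refl , z≡ , w≡))

      conclude : Primal es (λ _ → 0#) (λ _ → 0#) c ⊎ Dual es (λ _ → 0#) (λ _ → 0#) c →
        ∃[ Z ] ∃[ W ] dom F Z × dom F W ×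
          (∀ e → Cell (lookup X e) (lookup Y e) (lookup I e) (lookup Z e) (lookup W e)) ×
          value F X + value F Y ≤ value F Z + value F W
      conclude (inj₁ ((Z , Z′) , ((dZ , traceZ) , (dZ′ , traceZ′) , agree) , c≤)) =
        Z , ∁ Z′ , dZ , dZ′ ,
        (λ e → cell e
          (λ Be → lookup-∁ Z′ e (sym (agree e (∈-filter⁺ (λ e → em {B e}) (∈-allFin e) Be))))
          (traceZ e) (traceZ′ e)) ,
        ≤-trans c≤ (≤-reflexive
          (+-cong (≈.trans (+-cong ≈.refl (weight-zero Z)) (+-identityʳ _))
                  (≈.trans (+-cong ≈.refl (weight-zero Z′)) (+-identityʳ _))))
      -- Balance with zero weights makes `q₂` the negative of `q₁` on `B` and both zero elsewhere.
      -- `transfer` with `q₁` then yields independent sets whose joint score reaches `c`, which a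
      -- dual solution forbids.
      conclude (inj₂ (q₁ , q₂ , bal , low))
        with transfer F B q₁ is dX dY
               (λ e ¬Be Ye → ¬false⇒true (λ Xe → ¬Be (Ye , Xe)))
               (λ e e∈ → let (Xe , Ye) = I⊆ e (∈is⇒I e∈) in
                 (λ (Ye′ , _) → true≢false (trans (sym Ye′) Ye)) , Xe , Ye)
        where
        true≢false : true ≢ false
        true≢false ()
        ¬false⇒true : ∀ {b} → ¬ b ≡ false → b ≡ true
        ¬false⇒true {true}  _ = refl
        ¬false⇒true {false} h = contradiction refl h
      ... | U , V , dU , dV , trace , h = contradiction c≤ (low {U} {∁ V} (dU , traceU) dV′)
        where
        traceU : ∀ e → ¬ B e → lookup U e ≡ K₁ e
        traceU e ¬Be with lookup I e in Ie
        ... | true  = proj₁ (proj₁ (trace e ¬Be) (I⇒∈is Ie))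
        ... | false = proj₁ (proj₂ (trace e ¬Be) λ e∈ →
          contradiction (trans (sym (∈is⇒I e∈)) Ie) λ ())
        traceV : ∀ e → ¬ B e → lookup V e ≡ K₂ e
        traceV e ¬Be with lookup I e in Ie
        ... | true  = proj₂ (proj₁ (trace e ¬Be) (I⇒∈is Ie))
        ... | false = proj₂ (proj₂ (trace e ¬Be) λ e∈ →
          contradiction (trans (sym (∈is⇒I e∈)) Ie) λ ())
        dV′ : dom F₂ (∁ V)
        dV′ = subst (dom (restrict B K₂ F)) (sym (∁-involutive V)) (dV , traceV)
        termX : ∀ e → when (lookup X e) 0# + when (lookup X e) 0# ≤
                      when (lookup X e) (q₁ e) + when (lookup X e) 0#
        termX e with bal e
        ... | inj₁ (e∈ , _) rewrite proj₂ (∈es⇒B e∈) = ≤-refl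
        ... | inj₂ (q₁e , _) rewrite q₁e = ≤-refl
        termV : ∀ e → when (lookup V e) (q₁ e) + when (lookup V e) 0# ≤
                      when (lookup Y e) (q₁ e) + when (lookup (∁ V) e) (q₂ e)
        termV e rewrite lookup-map e not V with bal e
        ... | inj₂ (q₁e , q₂e) rewrite q₁e | q₂e = ≤-reflexive
          (≈.trans (+-cong (when-zero (lookup V e)) (when-zero (lookup V e)))
            (≈.sym (+-cong (when-zero (lookup Y e)) (when-zero (not (lookup V e))))))
        ... | inj₁ (e∈ , eq) rewrite proj₁ (∈es⇒B e∈) with lookup V e
        ...   | true  = ≤-refl
        ...   | false = ≤-reflexive (≈.sym eq)
        0≤X : 0# ≤ weight q₁ X
        0≤X = +-cancelʳ-≤ 0# (begin
          0# + 0#  ≈⟨ +-cong (weight-zero X) (weight-zero X) ⟨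
          weight (λ _ → 0#) X + weight (λ _ → 0#) X ≤⟨ weight-mono₂ X X X X termX ⟩
          weight q₁ X + weight (λ _ → 0#) X  ≈⟨ +-cong ≈.refl (weight-zero X) ⟩
          weight q₁ X + 0#  ∎)
        -- The weight of `Y` is that of all of `B`, and the complement of `V` contributes minus the
        -- weight of the part of `B` outside `V`; what is left is the weight of `V`.
        V≤Y : weight q₁ V ≤ weight q₁ Y + weight q₂ (∁ V)
        V≤Y = begin
          weight q₁ V                         ≈⟨ +-identityʳ _ ⟨
          weight q₁ V + 0#                    ≈⟨ +-cong ≈.refl (weight-zero V) ⟨
          weight q₁ V + weight (λ _ → 0#) V   ≤⟨ weight-mono₂ V V Y (∁ V) termV ⟩
          weight q₁ Y + weight q₂ (∁ V)       ∎
        c≤ : c ≤ joint q₁ q₂ (U , ∁ V)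
        c≤ = +-cancelʳ-≤ (weight q₁ Y) (begin
          c + weight q₁ Y
            ≈⟨ solve 3 (λ x y w → (x :+ y) :+ w ⊜ (x :+ id) :+ (y :+ w)) ≈.refl _ _ _ ⟩
          (value F X + 0#) + score F q₁ Y
            ≤⟨ +-monoˡ-≤ _ (+-monoʳ-≤ _ 0≤X) ⟩
          score F q₁ X + score F q₁ Y
            ≤⟨ h ⟩
          score F q₁ U + (value F V + weight q₁ V)
            ≤⟨ +-monoʳ-≤ _ (+-monoʳ-≤ _ V≤Y) ⟩
          score F q₁ U + (value F V + (weight q₁ Y + weight q₂ (∁ V)))
            ≈⟨ solve 4 (λ u v y w → u :+ (v :+ (y :+ w)) ⊜ (u :+ (v :+ w)) :+ y) ≈.refl _ _ _ _ ⟩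
          (score F q₁ U + (value F V + weight q₂ (∁ V))) + weight q₁ Y
            ≡⟨ cong (λ Z → (score F q₁ U + (value F Z + weight q₂ (∁ V))) + weight q₁ Y) (∁-involutive V) ⟨
          joint q₁ q₂ (U , ∁ V) + weight q₁ Y
            ∎)

-- Membership bits of set operations

lookup-─ : ∀ {n} (X Y : Subset n) e → lookup (X ─ Y) e ≡ lookup X e ∧ not (lookup Y e)
lookup-─ (x ∷ X) (true  ∷ Y) zero    = sym (∧-zeroʳ x)
lookup-─ (x ∷ X) (false ∷ Y) zero    = sym (∧-identityʳ x)
lookup-─ (x ∷ X) (y ∷ Y)     (suc e) = lookup-─ X Y e

module _ {n : ℕ} where

  lookup-ext : ∀ {X Y : Subset n} → (∀ e → lookup X e ≡ lookup Y e) → X ≡ Y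
  lookup-ext {X} {Y} h =
    trans (sym (tabulate∘lookup X)) (trans (tabulate-cong h) (tabulate∘lookup Y))

  ∉⇒lookup : ∀ {e} {X : Subset n} → ¬ e ∈ X → lookup X e ≡ false
  ∉⇒lookup {e} {X} e∉X with lookup X e in Xe
  ... | true  = contradiction (lookup⇒[]= e X Xe) e∉X
  ... | false = refl

  lookup-─⁻ : ∀ {X Y : Subset n} {e} → e ∈ X ─ Y → lookup X e ≡ true × lookup Y e ≡ false
  lookup-─⁻ {X} {Y} {e} e∈ with trans (sym (lookup-─ X Y e)) ([]=⇒lookup e∈)
  ... | eq with lookup X e | lookup Y e
  ...   | true | false = refl , refl

  lookup-─⁺ : ∀ {X Y : Subset n} {e} → lookup X e ≡ true → lookup Y e ≡ false → e ∈ X ─ Y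
  lookup-─⁺ {X} {Y} {e} Xe Ye = lookup⇒[]= e (X ─ Y)
    (trans (lookup-─ X Y e) (cong₂ (λ x y → x ∧ not y) Xe Ye))

  lookup-insert-same : ∀ (X : Subset n) i → lookup (X ⊕ i) i ≡ true
  lookup-insert-same X i rewrite lookup-zipWith _∨_ i X ⁅ i ⁆ | []=⇒lookup (x∈⁅x⁆ i) = ∨-zeroʳ _

  lookup-insert-other : ∀ (X : Subset n) {e i} → e ≢ i → lookup (X ⊕ i) e ≡ lookup X e
  lookup-insert-other X {e} {i} e≢i
    rewrite lookup-zipWith _∨_ e X ⁅ i ⁆ | ∉⇒lookup (x≢y⇒x∉⁅y⁆ e≢i) = ∨-identityʳ _

  lookup-remove-same : ∀ (X : Subset n) i → lookup (X - i) i ≡ false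
  lookup-remove-same X i rewrite lookup-─ X ⁅ i ⁆ i | []=⇒lookup (x∈⁅x⁆ i) = ∧-zeroʳ _

  lookup-remove-other : ∀ (X : Subset n) {e i} → e ≢ i → lookup (X - i) e ≡ lookup X e
  lookup-remove-other X {e} {i} e≢i rewrite lookup-─ X ⁅ i ⁆ e | ∉⇒lookup (x≢y⇒x∉⁅y⁆ e≢i) = ∧-identityʳ _

-- From M♮-concave functions to valuated functions

value₋ : ℝ ₋ → ℝ
value₋ ⊥₋    = 0ℝ
value₋ [ x ] = x

Finite : ℝ ₋ → Set
Finite a = ∃[ x ] a ≡ [ x ]

+₋-finite : ∀ {x} a b → [ x ] ≤₋ a +₋ b → Finite a × Finite b × x ≤ℝ value₋ a +ℝ value₋ b
+₋-finite [ a ] [ b ] [ x≤ ] = (a , refl) , (b , refl) , x≤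

module _ (em : ExcludedMiddle 0ℓ) where

  ℝ-divisibleOrderedGroup : DivisibleOrderedGroup
  ℝ-divisibleOrderedGroup = record
    { +-commutativeMonoid = +ℝ-commutativeMonoid
    ; isTotalOrder        = record
      { isPartialOrder = Poset.isPartialOrder ≤ℝ-poset ; total = ≤ℝ-total em }
    ; +-mono-≤ = λ {x} {y} {u} {v} → +ℝ-mono-≤ {x} {y} {u} {v}
    ; negative = λ x → -ℝ x , +ℝ-inverseʳ x
    ; half     = λ x → ½ℝ x , ½ℝ+½ℝ x
    ; 1#       = 1ℝ
    ; 1≰0      = 1ℝ≰0ℝ }

  -- The maximum of two Cauchy sequences is termwise and may alternate between them, so the choice
  -- is made by totality of the order: the larger real bounds the maximum.
  ⊔₋-sel-≤ : ∀ {x} a b → [ x ] ≤₋ a ⊔₋ b → [ x ] ≤₋ a ⊎ [ x ] ≤₋ b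
  ⊔₋-sel-≤ ⊥₋    b     h = inj₂ h
  ⊔₋-sel-≤ [ a ] ⊥₋    h = inj₁ h
  ⊔₋-sel-≤ {x} [ a ] [ b ] [ x≤ ] with ≤ℝ-total em a b
  ... | inj₁ a≤b = inj₂ [ ≤ℝ-trans {x} {a ⊔ℝ b} {b} x≤ a⊔b≤b ]
    where
    a⊔b≤b : a ⊔ℝ b ≤ℝ b
    a⊔b≤b ε 0<ε with a≤b ε 0<ε
    ... | K , h = K , λ n Kn → ℚ.⊔-lub (h n Kn) (≤-+ε {seq b n} 0<ε ℚ.≤-refl)
  ... | inj₂ b≤a = inj₁ [ ≤ℝ-trans {x} {a ⊔ℝ b} {a} x≤ a⊔b≤a ]
    where
    a⊔b≤a : a ⊔ℝ b ≤ℝ a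
    a⊔b≤a ε 0<ε with b≤a ε 0<ε
    ... | K , h = K , λ n Kn → ℚ.⊔-lub (≤-+ε {seq a n} 0<ε ℚ.≤-refl) (h n Kn)

  max-sel-≤ : ∀ {A : Set} {x} (g : A → ℝ ₋) js → [ x ] ≤₋ max (map g js) →
    ∃[ j ] j ∈ₗ js × [ x ] ≤₋ g j
  max-sel-≤ g (j ∷ js) h with ⊔₋-sel-≤ (g j) (max (map g js)) h
  ... | inj₁ x≤gj = j , here refl , x≤gj
  ... | inj₂ x≤   with max-sel-≤ g js x≤
  ...   | j′ , j′∈ , x≤gj′ = j′ , there j′∈ , x≤gj′

  module V = ValuatedExchange em ℝ-divisibleOrderedGroup

  -- The domain consists of the sets with finite value. A finite left side is bounded by a single
  -- alternative of the maximum, whose two summands are then finite; that alternative moves no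
  -- element or exactly one back in return for `i`.
  M♮⇒Valuated : ∀ {n} {f : Subset n → ℝ ₋} → M♮-Concave f → V.Valuated n
  M♮⇒Valuated {n} {f} M♮ = record
    { dom = λ Z → Finite (f Z) ; value = λ Z → value₋ (f Z) ; exchange = exch }
    where
    exch : ∀ {P Q} i → Finite (f P) → Finite (f Q) → lookup P i ≡ true → lookup Q i ≡ false →
      ∃[ P′ ] ∃[ Q′ ] Finite (f P′) × Finite (f Q′) × V.Moved i P Q P′ Q′ ×
        value₋ (f P) +ℝ value₋ (f Q) ≤ℝ value₋ (f P′) +ℝ value₋ (f Q′)
    exch {P} {Q} i (x , fP) (y , fQ) Pi Qi
      with M♮-Concave.exchange M♮ P Q i (lookup-─⁺ Pi Qi)
    ... | h rewrite fP | fQ with ⊔₋-sel-≤ (f (P - i) +₋ f (Q ⊕ i)) _ h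
    ...   | inj₁ h₁ with +₋-finite (f (P - i)) (f (Q ⊕ i)) h₁
    ...     | dP′ , dQ′ , x+y≤ = P - i , Q ⊕ i , dP′ , dQ′ ,
      (lookup-remove-same P i , lookup-insert-same Q i ,
       λ e e≢i → inj₁ (lookup-remove-other P e≢i , lookup-insert-other Q e≢i)) , x+y≤
    exch {P} {Q} i (x , fP) (y , fQ) Pi Qi | h | inj₂ h₂
      with max-sel-≤ (λ j → f (P - i ⊕ j) +₋ f (Q ⊕ i - j)) (elements (Q ─ P)) h₂
    ... | j , j∈ , h₃ with +₋-finite (f (P - i ⊕ j)) (f (Q ⊕ i - j)) h₃
                         | lookup-─⁻ (proj₂ (∈-filter⁻ (_∈? (Q ─ P)) {j} {allFin n} j∈))
    ...   | dP′ , dQ′ , x+y≤ | Qj , Pj = P - i ⊕ j , Q ⊕ i - j , dP′ , dQ′ ,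
      (trans (lookup-insert-other (P - i) i≢j) (lookup-remove-same P i) ,
       trans (lookup-remove-other (Q ⊕ i) i≢j) (lookup-insert-same Q i) , rest) , x+y≤
      where
      i≢j : i ≢ j
      i≢j refl = contradiction (trans (sym Pi) Pj) λ ()
      rest : ∀ e → e ≢ i →
        (lookup (P - i ⊕ j) e ≡ lookup P e × lookup (Q ⊕ i - j) e ≡ lookup Q e) ⊎
        (lookup P e ≡ false × lookup Q e ≡ true ×
         lookup (P - i ⊕ j) e ≡ true × lookup (Q ⊕ i - j) e ≡ false)
      rest e e≢i with e ≟ j
      ... | yes refl = inj₂ (Pj , Qj , lookup-insert-same (P - i) j , lookup-remove-same (Q ⊕ i) j)
      ... | no e≢j   = inj₁
        (trans (lookup-insert-other (P - i) e≢j) (lookup-remove-other P e≢i) ,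
         trans (lookup-remove-other (Q ⊕ i) e≢j) (lookup-insert-other Q e≢i))

  -- Truth-table check that J, taken as the part of Z in Y minus X, recovers both exchanged sets;
  -- the hypothesis on `i` rules out the rows where I leaves X minus Y.
  cell-exchange : ∀ x y i z w → V.Cell x y i z w →
    (i ≡ true → x ≡ true × y ≡ false) →
    (x ∧ not i) ∨ (z ∧ (y ∧ not x)) ≡ z × (y ∧ not (z ∧ (y ∧ not x))) ∨ i ≡ w
  cell-exchange _ _ true  _ _ (inj₁ (refl , refl , _)) I⊆ = contradiction (proj₁ (I⊆ refl)) λ ()
  cell-exchange _ _ false true  _ (inj₁ (refl , refl , refl)) _ = refl , refl
  cell-exchange _ _ false false _ (inj₁ (refl , refl , refl)) _ = refl , refl
  cell-exchange _ _ _ _ _ (inj₂ (_ , inj₁ (refl , refl , refl))) I⊆ with I⊆ refl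
  ... | refl , refl = refl , refl
  cell-exchange true  true  _ _ _ (inj₂ (_ , inj₂ (refl , refl , refl))) _ = refl , refl
  cell-exchange true  false _ _ _ (inj₂ (_ , inj₂ (refl , refl , refl))) _ = refl , refl
  cell-exchange false false _ _ _ (inj₂ (_ , inj₂ (refl , refl , refl))) _ = refl , refl
  cell-exchange false true  _ _ _ (inj₂ (¬B , inj₂ _)) _ = contradiction (refl , refl) ¬B

theorem1 : ExcludedMiddle 0ℓ →
    ∀ (n : ℕ) (f : Subset n → ℝ ₋) → M♮-Concave f →
    ∀ (X Y I : Subset n) → I ⊆ X ─ Y →
    ∃[ J ] (J ⊆ Y ─ X × f X +₋ f Y ≤₋ f ((X ─ I) ∪ J) +₋ f ((Y ─ J) ∪ I))
theorem1 em n f M♮ X Y I I⊆ with f X in fX | f Y in fY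
-- If either value is -∞, so is the left side, and the empty J will do.
... | ⊥₋    | _  = ∅ , (λ e∈ → ⊥-elim (∉⊥ e∈)) , ⊥₋≤ _
... | [ _ ] | ⊥₋ = ∅ , (λ e∈ → ⊥-elim (∉⊥ e∈)) , ⊥₋≤ _
... | [ x ] | [ y ]
  with V.multiple-exchange em (M♮⇒Valuated em M♮) X Y I (x , fX) (y , fY)
         (λ e Ie → lookup-─⁻ (I⊆ (lookup⇒[]= e I Ie)))
... | Z , W , (z , fZ) , (w , fW) , cell , x+y≤ =
  J , p∩q⊆q Z (Y ─ X) , conclude
  where
  J : Subset n
  J = Z ∩ (Y ─ X)

  lookup-J : ∀ e → lookup J e ≡ lookup Z e ∧ (lookup Y e ∧ not (lookup X e))
  lookup-J e = trans (lookup-zipWith _∧_ e Z (Y ─ X)) (cong (lookup Z e ∧_) (lookup-─ Y X e))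

  bits : ∀ e →
    (lookup X e ∧ not (lookup I e)) ∨ (lookup Z e ∧ (lookup Y e ∧ not (lookup X e))) ≡ lookup Z e ×
    (lookup Y e ∧ not (lookup Z e ∧ (lookup Y e ∧ not (lookup X e)))) ∨ lookup I e ≡ lookup W e
  bits e = cell-exchange em _ _ _ _ _ (cell e) (λ Ie → lookup-─⁻ (I⊆ (lookup⇒[]= e I Ie)))

  X′≡Z : (X ─ I) ∪ J ≡ Z
  X′≡Z = lookup-ext λ e → trans (lookup-zipWith _∨_ e (X ─ I) J)
    (trans (cong₂ _∨_ (lookup-─ X I e) (lookup-J e)) (proj₁ (bits e)))

  Y′≡W : (Y ─ J) ∪ I ≡ W
  Y′≡W = lookup-ext λ e → trans (lookup-zipWith _∨_ e (Y ─ J) I)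
    (trans (cong (_∨ lookup I e) (trans (lookup-─ Y J e) (cong (λ b → lookup Y e ∧ not b) (lookup-J e))))
           (proj₂ (bits e)))

  conclude : [ x +ℝ y ] ≤₋ f ((X ─ I) ∪ J) +₋ f ((Y ─ J) ∪ I)
  conclude rewrite X′≡Z | Y′≡W | fX | fY | fZ | fW = [ x+y≤ ]
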